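{- For integers $A,B\ge0$ put $J_{A,B}(t)=\sum_{k\ge0}\binom{A}{k}\binom{B}{k}t^k$. Fix an integer $\kappa\ge0$ and put $$\Delta_t(z)=\sqrt{\bigl(1+(1-t)z\bigr)^2-4z},$$ with the square-root branch $\Delta_t(0)=1$. Then $$\sum_{n\ge0}J_{n,n+\kappa}(t)z^n=\frac{1}{\Delta_t(z)}\left(\frac{1+(1-t)z-\Delta_t(z)}{2z}\right)^{\!\kappa}$$ as an identity of formal power series in $z$ with coefficients in $\mathbb{Q}[t]$; the quotient inside the power has a removable singularity at $z=0$ and constant term $1$. In particular, for every real $t\ge0$ and every fixed integer $\kappa\ge0$, $$\lim_{n\to\infty}J_{n,n+\kappa}(t)^{1/n}=(1+\sqrt t)^2.$$ -}

module Defs where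

open import Algebra.Bundles.Raw using (RawRing)
import Algebra.Definitions.RawSemiring as RawSemiringDefs
open import Data.Fin.Base using (toℕ; opposite)
open import Data.Integer.Base as ℤ using (+_; -[1+_])
import Data.Integer.Properties as ℤₚ
open import Data.List.Base using (List; []; _∷_; map; foldr; applyUpTo)
open import Data.Nat.Base as ℕ using (ℕ; zero; suc; _∸_)
open import Data.Nat.Combinatorics using (_C_)
import Data.Nat.Properties as ℕₚ
open import Data.Product.Base using (∃; _×_; _,_; proj₁; proj₂)
open import Data.Rational.Base using (ℚ; 0ℚ; 1ℚ; ½; _/_)
import Data.Rational.Base as ℚᵣ
import Data.Rational.Properties as ℚₚ
import Data.Rational.Unnormalised.Base as ℚᵘ
import Data.Rational.Unnormalised.Properties as ℚᵘₚ
open import Data.Rational.Solver using (module +-*-Solver)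
open import Data.Sum.Base using (_⊎_; inj₁; inj₂; [_,_]′)
open import Data.Vec.Base as Vec using (Vec; lookup)
open import Function.Base using (id)
open import Level using (0ℓ)
open import Relation.Binary.PropositionalEquality.Core
  using (_≡_; refl; sym; trans; cong; cong₂; subst; subst₂)
open import Relation.Nullary using (yes; no; contradiction)

------------------------------------------------------------------------
-- ℚ[t]: coefficient lists, constant term first.  Trailing zeros are
-- allowed, so equality compares coefficients.

module Polynomial where

  open import Data.Rational.Base using (_+_; _*_; -_)

  infixl 7 _*ₚ_
  infixl 6 _+ₚ_
  infix  4 _≈ₚ_

  Poly : Set
  Poly = List ℚ

  coeff : Poly → ℕ → ℚ
  coeff []      _       = 0ℚ
  coeff (a ∷ p) zero    = a
  coeff (a ∷ p) (suc k) = coeff p k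

  _≈ₚ_ : Poly → Poly → Set
  p ≈ₚ q = ∀ k → coeff p k ≡ coeff q k

  _+ₚ_ : Poly → Poly → Poly
  []      +ₚ q       = q
  (a ∷ p) +ₚ []      = a ∷ p
  (a ∷ p) +ₚ (b ∷ q) = (a + b) ∷ (p +ₚ q)

  _*ₚ_ : Poly → Poly → Poly
  []      *ₚ q = []
  (a ∷ p) *ₚ q = map (a *_) q +ₚ (0ℚ ∷ (p *ₚ q))

  constant : ℚ → Poly
  constant a = a ∷ []

  rawRing : RawRing 0ℓ 0ℓ
  rawRing = record
    { Carrier = Poly
    ; _≈_     = _≈ₚ_
    ; _+_     = _+ₚ_
    ; _*_     = _*ₚ_
    ; -_      = map (-_)
    ; 0#      = []
    ; 1#      = constant 1ℚ
    }

  indeterminate : Poly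
  indeterminate = 0ℚ ∷ 1ℚ ∷ []

-- J A B = Σ_{k ≥ 0} C(A,k) C(B,k) tᵏ; the terms with k > A vanish.

J : ℕ → ℕ → Polynomial.Poly
J A B = applyUpTo (λ k → + ((A C k) ℕ.* (B C k)) / 1) (suc A)

------------------------------------------------------------------------
-- R⟦z⟧ for a ring R in which ½ is the inverse of 1 + 1.  A series is its
-- sequence of coefficients.

module PowerSeries (R : RawRing 0ℓ 0ℓ) (½# : RawRing.Carrier R) where

  private module R = RawRing R
  open RawSemiringDefs R.rawSemiring using (sum)

  Series : Set
  Series = ℕ → R.Carrier

  _*ₛ_ : Series → Series → Series
  (f *ₛ g) n = sum {suc n} λ i → f (toℕ i) R.* g (n ∸ toℕ i)

  constant : R.Carrier → Series
  constant a zero    = a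
  constant a (suc _) = R.0#

  z : Series
  z (suc zero) = R.1#
  z _          = R.0#

  rawRing : RawRing 0ℓ 0ℓ
  rawRing = record
    { Carrier = Series
    ; _≈_     = λ f g → ∀ n → f n R.≈ g n
    ; _+_     = λ f g n → f n R.+ g n
    ; _*_     = _*ₛ_
    ; -_      = λ f n → R.- f n
    ; 0#      = λ _ → R.0#
    ; 1#      = constant R.1#
    }

  open RawRing rawRing public
    using (_≈_; _+_; _*_; -_; 0#; 1#)
  open RawSemiringDefs (RawRing.rawSemiring rawRing) public
    using (_^_) renaming (_×_ to _·_)

  infixl 6 _-_
  _-_ : Series → Series → Series
  f - g = f + (- g)

  constantTerm : Series → R.Carrier
  constantTerm f = f 0

  -- The inverse g of a series f with constant term 1: g₀ = 1 and
  -- gₙ₊₁ = - Σ_{i ≤ n} fᵢ₊₁ gₙ₋ᵢ.  The vector lists gₙ, …, g₀.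

  inverseCoeffs : Series → ∀ n → Vec R.Carrier (suc n)
  inverseCoeffs f zero    = R.1# Vec.∷ Vec.[]
  inverseCoeffs f (suc n) =
    (R.- sum (λ i → f (suc (toℕ i)) R.* lookup gs i)) Vec.∷ gs
    where gs = inverseCoeffs f n

  infix 9 _⁻¹
  _⁻¹ : Series → Series
  (f ⁻¹) n = Vec.head (inverseCoeffs f n)

  -- The square root 1 + z h of a series f with constant term 1.  From
  -- (1 + z h)² = 1 + z (2 h + z h²) one gets h₀ = ½ f₁ and
  -- hₙ₊₁ = ½ (fₙ₊₂ - Σ_{i ≤ n} hᵢ hₙ₋ᵢ).  The vector lists hₙ, …, h₀.

  sqrtCoeffs : Series → ∀ n → Vec R.Carrier (suc n)
  sqrtCoeffs f zero    = (½# R.* f 1) Vec.∷ Vec.[]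
  sqrtCoeffs f (suc n) =
    (½# R.* (f (suc (suc n)) R.+
      (R.- sum (λ i → lookup hs i R.* lookup hs (opposite i))))) Vec.∷ hs
    where hs = sqrtCoeffs f n

  sqrt : Series → Series
  sqrt f zero    = R.1#
  sqrt f (suc n) = Vec.head (sqrtCoeffs f n)

  -- The quotient by 2z, provided that f has constant term 0; in general
  -- that term is dropped, so 2z (f /2z) = f holds only in that case.

  infixl 7 _/2z
  _/2z : Series → Series
  (f /2z) n = ½# R.* f (suc n)

module ℚ[t]⟦z⟧ where

  open PowerSeries Polynomial.rawRing (Polynomial.constant ½) public

  t : Series
  t = constant Polynomial.indeterminate

  Δ : Series
  Δ = sqrt ((1# + (1# - t) * z) ^ 2 - 4 · z)

------------------------------------------------------------------------

open RawSemiringDefs (RawRing.rawSemiring ℚᵣ.+-*-rawRing)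
  using () renaming (_^_ to _^ℚ_; _×_ to _·ℚ_)

module Rational where

  open import Data.Rational.Base hiding (_/_; 0ℚ; 1ℚ; ½; ℚ)
  open import Data.Rational.Properties
  open +-*-Solver

  p≤∣p∣ : ∀ p → p ≤ ∣ p ∣
  p≤∣p∣ p with ≤-total 0ℚ p
  ... | inj₁ 0≤p = ≤-reflexive (sym (0≤p⇒∣p∣≡p 0≤p))
  ... | inj₂ p≤0 = ≤-trans p≤0 (0≤∣p∣ p)

  ∣p∣<ε : ∀ {p ε} → p < ε → - p < ε → ∣ p ∣ < ε
  ∣p∣<ε {p} {ε} p<ε -p<ε with ∣p∣≡p∨∣p∣≡-p p
  ... | inj₁ eq = subst (_< ε) (sym eq) p<ε
  ... | inj₂ eq = subst (_< ε) (sym eq) -p<ε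

  ∣p-q∣≡∣q-p∣ : ∀ p q → ∣ p - q ∣ ≡ ∣ q - p ∣
  ∣p-q∣≡∣q-p∣ p q = trans (sym (∣-p∣≡∣p∣ (p - q)))
    (cong ∣_∣ (solve 2 (λ p q → :- (p :- q) := q :- p) refl p q))

  ½+½ : ∀ ε → ½ * ε + ½ * ε ≡ ε
  ½+½ ε = trans (sym (*-distribʳ-+ ε ½ ½)) (*-identityˡ ε)

  *-pos : ∀ {p q} → 0ℚ < p → 0ℚ < q → 0ℚ < p * q
  *-pos {p} {q} 0<p 0<q = positive⁻¹ (p * q)
    {{pos*pos⇒pos p {{positive 0<p}} q {{positive 0<q}}}}

  *-mono-≤-nn : ∀ {p q r s} → 0ℚ ≤ p → 0ℚ ≤ s → p ≤ q → r ≤ s → p * r ≤ q * s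
  *-mono-≤-nn {p} {q} {r} {s} 0≤p 0≤s p≤q r≤s = ≤-trans
    (*-monoˡ-≤-nonNeg p {{nonNegative 0≤p}} r≤s)
    (*-monoʳ-≤-nonNeg s {{nonNegative 0≤s}} p≤q)

  0<½ε : ∀ {ε} → 0ℚ < ε → 0ℚ < ½ * ε
  0<½ε = *-pos (positive⁻¹ ½)

  ^-pos : ∀ {p} n → 0ℚ < p → 0ℚ < p ^ℚ n
  ^-pos zero    0<p = positive⁻¹ 1ℚ
  ^-pos (suc n) 0<p = *-pos 0<p (^-pos n 0<p)

  ^-nonNeg : ∀ {p} n → 0ℚ ≤ p → 0ℚ ≤ p ^ℚ n
  ^-nonNeg zero    0≤p = nonNegative⁻¹ 1ℚ
  ^-nonNeg {p} (suc n) 0≤p = nonNegative⁻¹ (p * (p ^ℚ n))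
    {{nonNeg*nonNeg⇒nonNeg p {{nonNegative 0≤p}} (p ^ℚ n) {{nonNegative (^-nonNeg n 0≤p)}}}}

  ^-mono-≤ : ∀ {p q} n → 0ℚ ≤ p → p ≤ q → p ^ℚ n ≤ q ^ℚ n
  ^-mono-≤ zero    0≤p p≤q = ≤-refl
  ^-mono-≤ (suc n) 0≤p p≤q =
    *-mono-≤-nn 0≤p (^-nonNeg n (≤-trans 0≤p p≤q)) p≤q (^-mono-≤ n 0≤p p≤q)

  p≤p+q : ∀ {p q} → 0ℚ ≤ q → p ≤ p + q
  p≤p+q {p} {q} 0≤q = subst (_≤ p + q) (+-identityʳ p) (+-monoʳ-≤ p 0≤q)

  +-nonNeg : ∀ {p q} → 0ℚ ≤ p → 0ℚ ≤ q → 0ℚ ≤ p + q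
  +-nonNeg 0≤p 0≤q = +-mono-≤ 0≤p 0≤q

  ^-superadditive : ∀ {p q} n → 0ℚ ≤ p → 0ℚ ≤ q →
                    p ^ℚ suc n + q ^ℚ suc n ≤ (p + q) ^ℚ suc n
  ^-superadditive {p} {q} n 0≤p 0≤q = subst (p ^ℚ suc n + q ^ℚ suc n ≤_)
    (sym (*-distribʳ-+ ((p + q) ^ℚ n) p q))
    (+-mono-≤
      (*-monoˡ-≤-nonNeg p {{nonNegative 0≤p}} (^-mono-≤ n 0≤p (p≤p+q 0≤q)))
      (*-monoˡ-≤-nonNeg q {{nonNegative 0≤q}}
        (^-mono-≤ n 0≤q (subst (q ≤_) (+-comm q p) (p≤p+q 0≤p)))))

  p≤q+∣p-q∣ : ∀ p q → p ≤ q + ∣ p - q ∣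
  p≤q+∣p-q∣ p q = subst (_≤ q + ∣ p - q ∣)
    (solve 2 (λ p q → q :+ (p :- q) := p) refl p q)
    (+-monoʳ-≤ q (p≤∣p∣ (p - q)))

  ∣p∣-∣q∣≤∣p-q∣ : ∀ p q → ∣ p ∣ - ∣ q ∣ ≤ ∣ p - q ∣
  ∣p∣-∣q∣≤∣p-q∣ p q = subst₂ _≤_
    (cong (λ x → ∣ x ∣ - ∣ q ∣) (solve 2 (λ p q → (p :- q) :+ q := p) refl p q))
    (solve 2 (λ a b → (a :+ b) :- b := a) refl ∣ p - q ∣ ∣ q ∣)
    (+-monoˡ-≤ (- ∣ q ∣) (∣p+q∣≤∣p∣+∣q∣ (p - q) q))

  abs-abs : ∀ p q → ∣ ∣ p ∣ - ∣ q ∣ ∣ ≤ ∣ p - q ∣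
  abs-abs p q with ∣p∣≡p∨∣p∣≡-p (∣ p ∣ - ∣ q ∣)
  ... | inj₁ eq = subst (_≤ ∣ p - q ∣) (sym eq) (∣p∣-∣q∣≤∣p-q∣ p q)
  ... | inj₂ eq = subst₂ _≤_
    (trans (solve 2 (λ a b → b :- a := :- (a :- b)) refl ∣ p ∣ ∣ q ∣) (sym eq))
    (∣p-q∣≡∣q-p∣ q p)
    (∣p∣-∣q∣≤∣p-q∣ q p)

  mesh : ℕ → ℚ
  mesh m = + 1 / suc m

  mesh-pos : ∀ m → 0ℚ < mesh m
  mesh-pos m = positive⁻¹ (mesh m) {{normalize-pos 1 (suc m)}}

  multiple-mesh : ∀ k m → k ·ℚ mesh m ≡ + k / suc m
  multiple-mesh zero    m = sym (0/n≡0 (suc m))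
  multiple-mesh (suc k) m = trans (cong (λ x → mesh m + x) (multiple-mesh k m)) (toℚᵘ-injective (begin
    toℚᵘ (mesh m + + k / suc m)                    ≈⟨ toℚᵘ-homo-+ (mesh m) (+ k / suc m) ⟩
    toℚᵘ (mesh m) ℚᵘ.+ toℚᵘ (+ k / suc m)
      ≈⟨ ℚᵘₚ.+-cong (toℚᵘ-fromℚᵘ (ℚᵘ.mkℚᵘ (+ 1) m)) (toℚᵘ-fromℚᵘ (ℚᵘ.mkℚᵘ (+ k) m)) ⟩
    ℚᵘ.mkℚᵘ (+ 1) m ℚᵘ.+ ℚᵘ.mkℚᵘ (+ k) m
      ≈⟨ ℚᵘ.*≡* lemma ⟩
    ℚᵘ.mkℚᵘ (+ suc k) m                           ≈⟨ toℚᵘ-fromℚᵘ (ℚᵘ.mkℚᵘ (+ suc k) m) ⟨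
    toℚᵘ (+ suc k / suc m) ∎))
    where
      open ℚᵘₚ.≃-Reasoning
      lemma : ((+ 1) ℤ.* (+ suc m) ℤ.+ (+ k) ℤ.* (+ suc m)) ℤ.* (+ suc m)
              ≡ (+ suc k) ℤ.* ((+ suc m) ℤ.* (+ suc m))
      lemma = trans (cong (ℤ._* (+ suc m)) (sym (ℤₚ.*-distribʳ-+ (+ suc m) (+ 1) (+ k))))
                    (ℤₚ.*-assoc (+ suc k) (+ suc m) (+ suc m))

  1≤/ : ∀ k m → suc m ℕ.≤ k → 1ℚ ≤ + k / suc m
  1≤/ k m m<k = toℚᵘ-cancel-≤ (ℚᵘₚ.≤-trans
    (ℚᵘ.*≤* {ℚᵘ.mkℚᵘ (+ 1) 0} {ℚᵘ.mkℚᵘ (+ k) m}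
      (subst₂ ℤ._≤_ (sym (ℤₚ.*-identityˡ (+ suc m))) (sym (ℤₚ.*-identityʳ (+ k))) (ℤ.+≤+ m<k)))
    (ℚᵘₚ.≤-reflexive (ℚᵘₚ.≃-sym (toℚᵘ-fromℚᵘ (ℚᵘ.mkℚᵘ (+ k) m)))))

  fuel : ℚ → ℕ → ℕ
  fuel q m = suc m ℕ.* suc ℤ.∣ ↥ q ∣

  q</fuel : ∀ q m → q < + fuel q m / suc m
  q</fuel q@record{} m = toℚᵘ-cancel-< (ℚᵘₚ.<-≤-trans
    (ℚᵘ.*<* {toℚᵘ q} {ℚᵘ.mkℚᵘ (+ fuel q m) m} (ℤₚ.≤-<-trans
      (ℤₚ.*-monoʳ-≤-nonNeg (+ suc m) (i≤∣i∣ (↥ q)))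
      (subst₂ ℤ._<_ (ℤₚ.pos-* ℤ.∣ ↥ q ∣ (suc m)) (ℤₚ.pos-* (fuel q m) (↧ₙ q))
        (ℤ.+<+ (begin-strict
          ℤ.∣ ↥ q ∣ ℕ.* suc m      ≡⟨ ℕₚ.*-comm ℤ.∣ ↥ q ∣ (suc m) ⟩
          suc m ℕ.* ℤ.∣ ↥ q ∣      <⟨ ℕₚ.*-monoʳ-< (suc m) (ℕₚ.n<1+n ℤ.∣ ↥ q ∣) ⟩
          fuel q m                 ≤⟨ ℕₚ.m≤m*n (fuel q m) (↧ₙ q) ⟩
          fuel q m ℕ.* ↧ₙ q        ∎)))))
    (ℚᵘₚ.≤-reflexive (ℚᵘₚ.≃-sym (toℚᵘ-fromℚᵘ (ℚᵘ.mkℚᵘ (+ fuel q m) m)))))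
    where
      open ℕₚ.≤-Reasoning
      i≤∣i∣ : ∀ i → i ℤ.≤ + ℤ.∣ i ∣
      i≤∣i∣ (+ n)    = ℤₚ.≤-refl
      i≤∣i∣ -[1+ n ] = ℤ.-≤+

  mesh-small : ∀ {ε} → 0ℚ < ε → ∃ λ N → ∀ m → N ℕ.≤ m → mesh m ≤ ε
  mesh-small {ε@(mkℚ (+ suc a) d _)} 0<ε = d , λ m d≤m → toℚᵘ-cancel-≤ (ℚᵘₚ.≤-trans
    (ℚᵘₚ.≤-reflexive (toℚᵘ-fromℚᵘ (ℚᵘ.mkℚᵘ (+ 1) m)))
    (ℚᵘ.*≤* {ℚᵘ.mkℚᵘ (+ 1) m} {toℚᵘ ε} (ℤ.+≤+
      (ℕₚ.*-mono-≤ (ℕ.s≤s (ℕ.z≤n {a})) (ℕ.s≤s d≤m)))))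
  mesh-small {mkℚ (+ 0) d _} 0<ε = contradiction 0<ε λ { (*<* (ℤ.+<+ ())) }
  mesh-small {mkℚ -[1+ n ] d _} 0<ε = contradiction 0<ε λ { (*<* ()) }

------------------------------------------------------------------------
-- approxRoot n q m is the largest multiple r ≥ 0 of 1/(m+1) with rⁿ ≤ q,
-- and 0 if there is none: step up from 0 as long as rⁿ ≤ q allows it.
-- For n ≥ 1 the (m+1)(1 + |numerator of q|) iterations are enough.

module Climb (n : ℕ) (q δ : ℚ) where

  open import Data.Rational.Base using (_+_; _≤_; _<_)
  open import Data.Rational.Properties
  open Rational

  step : ℚ → ℚ
  step r with (r + δ) ^ℚ n ≤? q
  ... | yes _ = r + δ
  ... | no  _ = r

  climb : ℕ → ℚ
  climb zero    = 0ℚ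
  climb (suc k) = step (climb k)

  Lower : ℚ → Set
  Lower r = 0ℚ ≤ r × (r ≡ 0ℚ ⊎ r ^ℚ n ≤ q)

  climb-lower : 0ℚ < δ → ∀ k → Lower (climb k)
  climb-lower 0<δ zero    = ≤-refl , inj₁ refl
  climb-lower 0<δ (suc k) = step-lower (climb k) (climb-lower 0<δ k)
    where
      step-lower : ∀ r → Lower r → Lower (step r)
      step-lower r lr with (r + δ) ^ℚ n ≤? q
      ... | yes le = +-nonNeg {r} {δ} (proj₁ lr) (<⇒≤ 0<δ) , inj₂ le
      ... | no  _  = lr

  Upper : ℕ → ℚ → Set
  Upper k r = q < (r + δ) ^ℚ n ⊎ r ≡ k ·ℚ δ

  climb-upper : ∀ k → Upper k (climb k)
  climb-upper zero    = inj₂ refl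
  climb-upper (suc k) = step-upper (climb k) (climb-upper k)
    where
      step-upper : ∀ r → Upper k r → Upper (suc k) (step r)
      step-upper r ur with (r + δ) ^ℚ n ≤? q
      ... | no ¬le = inj₁ (≰⇒> ¬le)
      ... | yes le with ur
      ...   | inj₁ lt = contradiction (<-≤-trans lt le) (<-irrefl refl)
      ...   | inj₂ eq = inj₂ (trans (+-comm r δ) (cong (λ x → δ + x) eq))

approxRoot : ℕ → ℚ → ℕ → ℚ
approxRoot n q m = Climb.climb n q (Rational.mesh m) (Rational.fuel q m)

module ApproxRoot (n : ℕ) (q : ℚ) (m : ℕ) where

  open import Data.Rational.Base using (_+_; _≤_; _<_)
  open import Data.Rational.Properties
  open Rational

  nonNeg : 0ℚ ≤ approxRoot n q m
  nonNeg = proj₁ (Climb.climb-lower n q (mesh m) (mesh-pos m) (fuel q m))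

  lower : approxRoot n q m ≡ 0ℚ ⊎ approxRoot n q m ^ℚ n ≤ q
  lower = proj₂ (Climb.climb-lower n q (mesh m) (mesh-pos m) (fuel q m))

  exceeds : ∀ {x y} n .{{_ : ℕ.NonZero n}} → q < x → 1ℚ ≤ x → x ≤ y → q < y ^ℚ n
  exceeds {x} {y} (suc n) q<x 1≤x x≤y =
    <-≤-trans q<x (subst (_≤ y ^ℚ suc n) (*-identityʳ x)
      (*-mono-≤-nn {x} {y} {1ℚ} {y ^ℚ n} 0≤x (^-nonNeg n 0≤y) x≤y (1≤^ n)))
    where
      0≤x : 0ℚ ≤ x
      0≤x = ≤-trans (nonNegative⁻¹ 1ℚ) 1≤x

      0≤y : 0ℚ ≤ y
      0≤y = ≤-trans 0≤x x≤y

      1≤^ : ∀ n → 1ℚ ≤ y ^ℚ n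
      1≤^ zero    = ≤-refl
      1≤^ (suc n) = *-mono-≤-nn {1ℚ} {y} {1ℚ} {y ^ℚ n} (nonNegative⁻¹ 1ℚ)
        (^-nonNeg n 0≤y) (≤-trans 1≤x x≤y) (1≤^ n)

  upper : .{{ℕ.NonZero n}} → q < (approxRoot n q m + mesh m) ^ℚ n
  upper = bound (approxRoot n q m) (Climb.climb-upper n q (mesh m) (fuel q m))
    where
      bound : ∀ r → q < (r + mesh m) ^ℚ n ⊎ r ≡ fuel q m ·ℚ mesh m → q < (r + mesh m) ^ℚ n
      bound r (inj₁ lt) = lt
      bound r (inj₂ eq) = exceeds n
        (subst (q <_) (sym r≡) (q</fuel q m))
        (subst (1ℚ ≤_) (sym r≡) (1≤/ (fuel q m) m (ℕₚ.m≤m*n (suc m) _)))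
        (p≤p+q {r} {mesh m} (<⇒≤ (mesh-pos m)))
        where
          r≡ : r ≡ + fuel q m / suc m
          r≡ = trans eq (multiple-mesh (fuel q m) m)

module _ where

  open import Data.Rational.Base using (_+_; _-_; -_; _≤_; _<_; ∣_∣)
  open import Data.Rational.Properties
  open +-*-Solver
  open Rational

  root-close : ∀ n .{{_ : ℕ.NonZero n}} {a b u v δ ε} → 0ℚ < ε → 0ℚ ≤ v → 0ℚ < δ →
    u ≡ 0ℚ ⊎ u ^ℚ n ≤ a → b < (v + δ) ^ℚ n →
    ∣ a - b ∣ < (½ ℚᵣ.* ε) ^ℚ n → δ ≤ ½ ℚᵣ.* ε → u - v < ε
  root-close (suc n) {a} {b} {u} {v} {δ} {ε} 0<ε 0≤v 0<δ lower upper a-b<ηⁿ δ≤η with u - v <? ε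
  ... | yes lt = lt
  ... | no ¬lt = contradiction (<-trans a-b<ηⁿ ηⁿ<∣a-b∣) (<-irrefl refl)
    where
      η : ℚ
      η = ½ ℚᵣ.* ε

      0≤η : 0ℚ ≤ η
      0≤η = <⇒≤ (0<½ε 0<ε)

      0≤v+δ : 0ℚ ≤ v + δ
      0≤v+δ = +-nonNeg {v} {δ} 0≤v (<⇒≤ 0<δ)

      v+ε≤u : v + ε ≤ u
      v+ε≤u = subst (v + ε ≤_) (solve 2 (λ u v → v :+ (u :- v) := u) refl u v)
                    (+-monoʳ-≤ v (≮⇒≥ ¬lt))

      v+δ+η≤u : (v + δ) + η ≤ u
      v+δ+η≤u = ≤-trans (+-monoˡ-≤ η (+-monoʳ-≤ v δ≤η))
        (subst (_≤ u) (trans (cong (λ x → v + x) (sym (½+½ ε))) (sym (+-assoc v η η))) v+ε≤u)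

      0<u : 0ℚ < u
      0<u = <-≤-trans (+-mono-≤-< 0≤v 0<ε) v+ε≤u

      uⁿ≤a : u ^ℚ suc n ≤ a
      uⁿ≤a = [ (λ u≡0 → contradiction 0<u (<-irrefl (sym u≡0))) , id ]′ lower

      b+ηⁿ<a : b + η ^ℚ suc n < a
      b+ηⁿ<a = <-≤-trans
        (+-monoˡ-< (η ^ℚ suc n) upper)
        (≤-trans (^-superadditive n 0≤v+δ 0≤η)
          (≤-trans (^-mono-≤ (suc n) (+-nonNeg {v + δ} {η} 0≤v+δ 0≤η) v+δ+η≤u) uⁿ≤a))

      ηⁿ<∣a-b∣ : η ^ℚ suc n < ∣ a - b ∣
      ηⁿ<∣a-b∣ = <-≤-trans
        (subst (_< a - b) (solve 2 (λ b x → (b :+ x) :- b := x) refl b (η ^ℚ suc n))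
          (+-monoˡ-< (- b) b+ηⁿ<a))
        (p≤∣p∣ (a - b))

  approxRoot-close : ∀ n .{{_ : ℕ.NonZero n}} {a b ε} l m → 0ℚ < ε →
    ∣ a - b ∣ < (½ ℚᵣ.* ε) ^ℚ n → mesh m ≤ ½ ℚᵣ.* ε →
    approxRoot n a l - approxRoot n b m < ε
  approxRoot-close n {a} {b} l m 0<ε = root-close n 0<ε
    (ApproxRoot.nonNeg n b m) (mesh-pos m) (ApproxRoot.lower n a l) (ApproxRoot.upper n b m)

------------------------------------------------------------------------
-- ℝ: Cauchy sequences of rationals with a modulus of convergence, up to
-- vanishing difference.

module Real where

  open Rational
  open ℚᵣ using (∣_∣) renaming (_+_ to _+ℚ_; _*_ to _*ℚ_; _-_ to _-ℚ_; -_ to -ℚ_; _<_ to _<ℚ_)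

  record ℝ : Set where
    constructor mkℝ
    field
      seq    : ℕ → ℚ
      cauchy : ∀ ε → 0ℚ <ℚ ε → ∃ λ N →
               ∀ {m n} → N ℕ.≤ m → N ℕ.≤ n → ∣ seq m -ℚ seq n ∣ <ℚ ε

  open ℝ public

  infix 4 _≈_ _≤_

  _≈_ : ℝ → ℝ → Set
  x ≈ y = ∀ ε → 0ℚ <ℚ ε → ∃ λ N → ∀ {n} → N ℕ.≤ n → ∣ seq x n -ℚ seq y n ∣ <ℚ ε

  _≤_ : ℝ → ℝ → Set
  x ≤ y = ∀ ε → 0ℚ <ℚ ε → ∃ λ N → ∀ {n} → N ℕ.≤ n → seq x n <ℚ seq y n +ℚ ε

  private
    module ℚS = +-*-Solver

  +-bound : ∀ {a b c d ε} → ∣ a -ℚ b ∣ <ℚ ½ *ℚ ε → ∣ c -ℚ d ∣ <ℚ ½ *ℚ ε →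
            ∣ (a +ℚ c) -ℚ (b +ℚ d) ∣ <ℚ ε
  +-bound {a} {b} {c} {d} {ε} p q = subst₂ _<ℚ_
    (cong ∣_∣ (ℚS.solve 4 (λ a b c d → (a :- b) :+ (c :- d) := (a :+ c) :- (b :+ d)) refl a b c d))
    (½+½ ε)
    (ℚₚ.≤-<-trans (ℚₚ.∣p+q∣≤∣p∣+∣q∣ (a -ℚ b) (c -ℚ d)) (ℚₚ.+-mono-< p q))
    where open ℚS

  ≤-max-l : ∀ {M N n} → M ℕ.⊔ N ℕ.≤ n → M ℕ.≤ n
  ≤-max-l {M} {N} = ℕₚ.≤-trans (ℕₚ.m≤m⊔n M N)

  ≤-max-r : ∀ {M N n} → M ℕ.⊔ N ℕ.≤ n → N ℕ.≤ n
  ≤-max-r {M} {N} = ℕₚ.≤-trans (ℕₚ.m≤n⊔m M N)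

  *-bound : ∀ {a b c d B ε} → 0ℚ <ℚ B → ∣ a ∣ <ℚ B → ∣ d ∣ <ℚ B →
            B *ℚ ∣ a -ℚ b ∣ <ℚ ½ *ℚ ε → B *ℚ ∣ c -ℚ d ∣ <ℚ ½ *ℚ ε →
            ∣ (a *ℚ c) -ℚ (b *ℚ d) ∣ <ℚ ε
  *-bound {a} {b} {c} {d} {B} {ε} 0<B a<B d<B p q = subst₂ _<ℚ_
    (cong ∣_∣ (ℚS.solve 4 (λ a b c d → d :* (a :- b) :+ a :* (c :- d) := (a :* c) :- (b :* d)) refl a b c d))
    (½+½ ε)
    (ℚₚ.≤-<-trans (ℚₚ.∣p+q∣≤∣p∣+∣q∣ (d *ℚ (a -ℚ b)) (a *ℚ (c -ℚ d)))
      (ℚₚ.+-mono-< (ℚₚ.≤-<-trans (scale d (a -ℚ b) d<B) p)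
                   (ℚₚ.≤-<-trans (scale a (c -ℚ d) a<B) q)))
    where
      open ℚS
      open ℚᵣ using () renaming (_≤_ to _≤ℚ_)
      scale : ∀ u v → ∣ u ∣ <ℚ B → ∣ u *ℚ v ∣ ≤ℚ B *ℚ ∣ v ∣
      scale u v u<B = subst (ℚᵣ._≤ B *ℚ ∣ v ∣) (sym (ℚₚ.∣p*q∣≡∣p∣*∣q∣ u v))
        (ℚₚ.*-monoʳ-≤-nonNeg ∣ v ∣ {{ℚₚ.∣-∣-nonNeg v}} (ℚₚ.<⇒≤ u<B))

  bounded : ∀ x → ∃ λ B → 0ℚ <ℚ B × ∃ λ N → ∀ {n} → N ℕ.≤ n → ∣ seq x n ∣ <ℚ B
  bounded x with cauchy x 1ℚ (ℚₚ.positive⁻¹ 1ℚ)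
  ... | N , h = B , ℚₚ.≤-<-trans (ℚₚ.0≤∣p∣ (seq x N)) a<B , N , λ {n} N≤n →
        ℚₚ.≤-<-trans (p≤q+∣p-q∣ ∣ seq x n ∣ ∣ seq x N ∣)
          (ℚₚ.+-monoʳ-< ∣ seq x N ∣ (ℚₚ.≤-<-trans (abs-abs (seq x n) (seq x N)) (h N≤n ℕₚ.≤-refl)))
    where
      B : ℚ
      B = ∣ seq x N ∣ +ℚ 1ℚ
      a<B : ∣ seq x N ∣ <ℚ B
      a<B = subst (_<ℚ B) (ℚₚ.+-identityʳ ∣ seq x N ∣) (ℚₚ.+-monoʳ-< ∣ seq x N ∣ (ℚₚ.positive⁻¹ 1ℚ))

  shrink : ∀ {B ε} → 0ℚ <ℚ B → 0ℚ <ℚ ε → ∃ λ δ → 0ℚ <ℚ δ × B *ℚ δ ≡ ½ *ℚ ε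
  shrink {B} {ε} 0<B 0<ε = 1/B *ℚ (½ *ℚ ε) , *-pos (ℚₚ.positive⁻¹ 1/B {{ℚₚ.1/pos⇒pos B {{ℚᵣ.positive 0<B}}}}) (0<½ε 0<ε) ,
    trans (sym (ℚₚ.*-assoc B 1/B (½ *ℚ ε)))
      (trans (cong (_*ℚ (½ *ℚ ε)) (ℚₚ.*-inverseʳ B)) (ℚₚ.*-identityˡ (½ *ℚ ε)))
    where
      instance _ = ℚᵣ.>-nonZero 0<B
      1/B : ℚ
      1/B = ℚᵣ.1/ B

  fromℚ : ℚ → ℝ
  fromℚ p = mkℝ (λ _ → p) λ ε 0<ε → 0 , λ _ _ →
    subst (_<ℚ _) (sym (cong ∣_∣ (ℚₚ.+-inverseʳ p))) 0<ε

  infixl 6 _+_ _-_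
  infixl 7 _*_
  infix  8 -_

  _+_ : ℝ → ℝ → ℝ
  x + y = mkℝ (λ n → seq x n +ℚ seq y n) λ ε 0<ε →
    let M , p = cauchy x (½ *ℚ ε) (0<½ε 0<ε)
        N , q = cauchy y (½ *ℚ ε) (0<½ε 0<ε)
    in M ℕ.⊔ N , λ h k →
         +-bound {seq x _} {seq x _} {seq y _} {seq y _}
                 (p (≤-max-l {M} {N} h) (≤-max-l {M} {N} k)) (q (≤-max-r {M} {N} h) (≤-max-r {M} {N} k))

  -_ : ℝ → ℝ
  - x = mkℝ (λ n → -ℚ seq x n) λ ε 0<ε →
    let N , p = cauchy x ε 0<ε
    in N , λ {m} {n} h k → subst (_<ℚ _)
         (trans (sym (ℚₚ.∣-p∣≡∣p∣ (seq x m -ℚ seq x n)))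
                (cong ∣_∣ (ℚₚ.neg-distrib-+ (seq x m) (-ℚ seq x n))))
         (p h k)

  _-_ : ℝ → ℝ → ℝ
  x - y = x + (- y)

  _*_ : ℝ → ℝ → ℝ
  x * y = mkℝ (λ n → seq x n *ℚ seq y n) λ ε 0<ε →
    let B₁ , 0<B₁ , N₁ , b₁ = bounded x
        B₂ , 0<B₂ , N₂ , b₂ = bounded y
        B = B₁ +ℚ B₂
        0<B = ℚₚ.+-mono-< 0<B₁ 0<B₂
        δ , 0<δ , Bδ = shrink {B} {ε} 0<B 0<ε
        M₁ , p = cauchy x δ 0<δ
        M₂ , q = cauchy y δ 0<δ
        B₁≤B = p≤p+q {B₁} {B₂} (ℚₚ.<⇒≤ 0<B₂)
        B₂≤B = subst (B₂ ℚᵣ.≤_) (ℚₚ.+-comm B₂ B₁) (p≤p+q {B₂} {B₁} (ℚₚ.<⇒≤ 0<B₁))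
        below = λ {v} (v<δ : v <ℚ δ) → subst (B *ℚ v <ℚ_) Bδ
                  (ℚₚ.*-monoʳ-<-pos B {{ℚᵣ.positive 0<B}} v<δ)
    in (N₁ ℕ.⊔ N₂) ℕ.⊔ (M₁ ℕ.⊔ M₂) , λ {m} {n} h k →
         let h₁ = ≤-max-l {N₁ ℕ.⊔ N₂} {M₁ ℕ.⊔ M₂} h
             h₂ = ≤-max-r {N₁ ℕ.⊔ N₂} {M₁ ℕ.⊔ M₂} h
             k₁ = ≤-max-l {N₁ ℕ.⊔ N₂} {M₁ ℕ.⊔ M₂} k
             k₂ = ≤-max-r {N₁ ℕ.⊔ N₂} {M₁ ℕ.⊔ M₂} k
         in *-bound {seq x m} {seq x n} {seq y m} {seq y n} {B} {ε} 0<B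
              (ℚₚ.<-≤-trans (b₁ (≤-max-l {N₁} {N₂} h₁)) B₁≤B)
              (ℚₚ.<-≤-trans (b₂ (≤-max-r {N₁} {N₂} k₁)) B₂≤B)
              (below (p (≤-max-l {M₁} {M₂} h₂) (≤-max-l {M₁} {M₂} k₂)))
              (below (q (≤-max-r {M₁} {M₂} h₂) (≤-max-r {M₁} {M₂} k₂)))

  ∣_∣ᵣ : ℝ → ℝ
  ∣ x ∣ᵣ = mkℝ (λ n → ∣ seq x n ∣) λ ε 0<ε →
    let N , p = cauchy x ε 0<ε
    in N , λ {m} {n} h k → ℚₚ.≤-<-trans (abs-abs (seq x m) (seq x n)) (p h k)

  rawRing : RawRing 0ℓ 0ℓ
  rawRing = record
    { Carrier = ℝ
    ; _≈_     = _≈_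
    ; _+_     = _+_
    ; _*_     = _*_
    ; -_      = -_
    ; 0#      = fromℚ 0ℚ
    ; 1#      = fromℚ 1ℚ
    }

  open RawRing rawRing public using (0#; 1#)
  open RawSemiringDefs (RawRing.rawSemiring rawRing) public using (_^_)

  -- The n-th root of max(x, 0).

  root : (n : ℕ) .{{_ : ℕ.NonZero n}} → ℝ → ℝ
  root n x = mkℝ (λ m → approxRoot n (seq x m) m) λ ε 0<ε →
    let N , p = cauchy x ((½ *ℚ ε) ^ℚ n) (^-pos n (0<½ε 0<ε))
        M , q = mesh-small (0<½ε 0<ε)
    in N ℕ.⊔ M , λ {i} {j} h k →
         ∣p∣<ε
           (approxRoot-close n i j 0<ε (p (≤-max-l {N} {M} h) (≤-max-l {N} {M} k)) (q j (≤-max-r {N} {M} k)))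
           (subst (_<ℚ ε) (swap (approxRoot n (seq x j) j) (approxRoot n (seq x i) i))
             (approxRoot-close n j i 0<ε (p (≤-max-l {N} {M} k) (≤-max-l {N} {M} h)) (q i (≤-max-r {N} {M} h))))
    where
      swap : ∀ u v → u -ℚ v ≡ -ℚ (v -ℚ u)
      swap = solve 2 (λ u v → u :- v := :- (v :- u)) refl
        where open ℚS

  √_ : ℝ → ℝ
  √_ = root 2

  ⟦_⟧ : Polynomial.Poly → ℝ → ℝ
  ⟦ p ⟧ x = foldr (λ a v → fromℚ a + x * v) 0# p

  -- Convergence of a sequence indexed by the positive integers; rational
  -- ε suffice.

  infix 4 _⟶_
  _⟶_ : ((n : ℕ) .{{_ : ℕ.NonZero n}} → ℝ) → ℝ → Set
  a ⟶ l = ∀ ε → 0ℚ <ℚ ε → ∃ λ N → ∀ n .{{_ : ℕ.NonZero n}} → N ℕ.≤ n →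
          ∣ a n - l ∣ᵣ ≤ fromℚ ε

module Submission where

open import Defs
import Algebra.Definitions.RawSemiring as RawSemiringDefs
open import Algebra.Bundles using (CommutativeRing)
import Algebra.Morphism.RingMonomorphism as RingMonomorphism
open import Algebra.Morphism.Structures using (IsRingMonomorphism)
import Algebra.Properties.CommutativeSemiring.Exp as CommutativeSemiringExp
import Algebra.Properties.Ring as RingProperties
import Algebra.Properties.Semiring.Mult as SemiringMult
import Algebra.Properties.Semiring.Sum as SemiringSum
import Algebra.Solver.Ring.NaturalCoefficients.Default as NatSolver
open import Algebra.Structures using (IsCommutativeRing)
open import Data.Fin.Base as Fin using (toℕ; opposite)
import Data.Fin.Properties as Finₚ
open import Data.Integer.Base using (+_)
open import Data.List.Base using ([]; _∷_; map; applyUpTo; foldr)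
open import Data.Nat.Base as ℕ using (ℕ; zero; suc; _∸_) renaming (_+_ to _+ℕ_)
open import Data.Nat.Combinatorics using (_C_; k>n⇒nCk≡0; nCk+nC[k+1]≡[n+1]C[k+1])
import Data.Nat.Properties as ℕₚ
import Data.Nat.Solver as ℕSolver
open import Data.Product.Base using (_×_; _,_; proj₁; proj₂; ∃)
open import Data.Rational.Base as ℚ using (ℚ; 0ℚ; 1ℚ; ½; _/_)
import Data.Rational.Properties as ℚₚ
import Data.Rational.Solver as ℚSolver
open import Data.Sum.Base using (_⊎_; inj₁; inj₂; [_,_]′)
open import Data.Vec.Base using (lookup)
open import Function.Base using (_∘_)
open import Level using (0ℓ)
open import Relation.Binary.PropositionalEquality.Core as ≡
  using (_≡_; refl; sym; trans; cong; cong₂; subst; subst₂)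
open import Relation.Binary.PropositionalEquality.Properties using (module ≡-Reasoning)
import Relation.Binary.Reasoning.Setoid as SetoidReasoning
open import Relation.Nullary using (yes; no; contradiction)

-- Put F_κ = Σ_n J_{n,n+κ} zⁿ and a = 1 + (1 - t) z.  Pascal's rule gives
-- J_{A+1,B} + J_{A,B+1} + t J_{A,B} = J_{A+1,B+1} + J_{A,B}, that is
-- F_κ + z F_{κ+2} = a F_{κ+1}, a recurrence in κ which determines every F_κ
-- from F_0.  The quotient q satisfies 1 + z q² = a q, so F_κ = F_0 q^κ.  For
-- A = B the symmetry of J turns Pascal's rule into a F_0 = 2 z F_1 + 1, and
-- with F_1 = q F_0 this is Δ F_0 = 1, because Δ = a - 2 z q.
--
-- For s ≥ 0 put x_k = C(n,k) sᵏ and y_k = C(n+κ,k) sᵏ; then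
-- J_{n,n+κ}(s²) = Σ x_k y_k is at most (Σ x_k)(Σ y_k) ≤ (1 + s)^(2n+κ), and at
-- least Σ x_k² ≥ (1 + s)^(2n) / (n + 1) by Cauchy-Schwarz.  The factors
-- (1 + s)^κ and n + 1 are dominated by (1 + e)ⁿ for every e > 0.

-- The recurrence in κ has order two, yet one initial series suffices: `F (κ + 2)` enters only with
-- a factor z, so coefficient n + 1 of `F (κ + 1)` depends on `F κ` and on coefficients of index n.
--
-- The limit is shaped by the representation of reals. There x is close to 0, and J(x) is close to
-- its constant coefficient 1, which replaces that bound.
--
-- Two tolerances occur: ε from the definition of the limit and ε′ from the definition of ≤ on
-- reals. The threshold for n must not depend on ε′. Hence the factors (1 + s)^κ and n + 1 are
-- charged to ε, while all errors of approximation, whose constants may depend on n, are charged to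
-- ε′.

-- Formal power series over a commutative ring

module SeriesRing (R : CommutativeRing 0ℓ 0ℓ) (½# : CommutativeRing.Carrier R) where

  private
    module R = CommutativeRing R
    module P = PowerSeries R.rawRing ½#
  open P using (Series; _*ₛ_)
  open SemiringSum R.semiring using (sum-cong-≋; *-distribˡ-sum; ∑-distrib-+)
  open SetoidReasoning R.setoid
  open NatSolver R.commutativeSemiring using (solve; _:+_; _:*_; _:=_; con)

  infix 4 _≈_
  _≈_ : Series → Series → Set
  f ≈ g = ∀ n → f n R.≈ g n

  tail : Series → Series
  tail f n = f (suc n)

  *-cong : ∀ {f f′ g g′} → f ≈ f′ → g ≈ g′ → f *ₛ g ≈ f′ *ₛ g′
  *-cong p q n = sum-cong-≋ {suc n} λ i → R.*-cong (p (toℕ i)) (q (n ∸ toℕ i))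

  *-zeroˡ : ∀ {f} → f ≈ P.0# → ∀ g → f *ₛ g ≈ P.0#
  *-zeroˡ f≈0 g zero    = R.trans (R.+-identityʳ _) (R.trans (R.*-congʳ (f≈0 0)) (R.zeroˡ _))
  *-zeroˡ f≈0 g (suc n) = R.trans
    (R.+-cong (R.trans (R.*-congʳ (f≈0 0)) (R.zeroˡ _)) (*-zeroˡ (f≈0 ∘ suc) g n))
    (R.+-identityˡ _)

  *-constant : ∀ a {f g} → f 0 R.≈ a → tail f ≈ P.0# → ∀ n → (f *ₛ g) n R.≈ a R.* g n
  *-constant a f0 f≈0 zero        = R.trans (R.+-identityʳ _) (R.*-congʳ f0)
  *-constant a {g = g} f0 f≈0 (suc n) =
    R.trans (R.+-cong (R.*-congʳ f0) (*-zeroˡ f≈0 g n)) (R.+-identityʳ _)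

  *-identityˡ : ∀ f → P.1# *ₛ f ≈ f
  *-identityˡ f n = R.trans (*-constant R.1# {P.1#} {f} R.refl (λ _ → R.refl) n) (R.*-identityˡ _)

  -- The convolution sum splits off its first summand by definition; this is the split at the last
  -- summand. Using both gives commutativity by induction.
  *-sucʳ : ∀ n f g → (f *ₛ g) (suc n) R.≈ f (suc n) R.* g 0 R.+ (f *ₛ tail g) n
  *-sucʳ zero    f g = solve 2 (λ a b → a :+ (b :+ con 0) := b :+ (a :+ con 0)) R.refl _ _
  *-sucʳ (suc n) f g = begin
    f 0 R.* g (suc (suc n)) R.+ (tail f *ₛ g) (suc n)
      ≈⟨ R.+-congˡ (*-sucʳ n (tail f) g) ⟩
    f 0 R.* g (suc (suc n)) R.+ (f (suc (suc n)) R.* g 0 R.+ (tail f *ₛ tail g) n)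
      ≈⟨ solve 3 (λ a b c → a :+ (b :+ c) := b :+ (a :+ c)) R.refl _ _ _ ⟩
    f (suc (suc n)) R.* g 0 R.+ (f *ₛ tail g) (suc n) ∎

  *-comm : ∀ f g → f *ₛ g ≈ g *ₛ f
  *-comm f g zero    = R.+-congʳ (R.*-comm _ _)
  *-comm f g (suc n) = R.trans (*-sucʳ n f g)
    (R.+-cong (R.*-comm _ _) (*-comm f (tail g) n))

  *-distribˡ : ∀ f g h → f *ₛ (g P.+ h) ≈ (f *ₛ g) P.+ (f *ₛ h)
  *-distribˡ f g h n = R.trans
    (sum-cong-≋ {suc n} λ i → R.distribˡ (f (toℕ i)) (g (n ∸ toℕ i)) (h (n ∸ toℕ i)))
    (∑-distrib-+ {suc n} (λ i → f (toℕ i) R.* g (n ∸ toℕ i)) (λ i → f (toℕ i) R.* h (n ∸ toℕ i)))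

  *-distribʳ : ∀ f g h → (g P.+ h) *ₛ f ≈ (g *ₛ f) P.+ (h *ₛ f)
  *-distribʳ f g h n = R.trans (*-comm (g P.+ h) f n)
    (R.trans (*-distribˡ f g h n) (R.+-cong (*-comm f g n) (*-comm f h n)))

  *-scale : ∀ a f g n → ((λ k → a R.* f k) *ₛ g) n R.≈ a R.* (f *ₛ g) n
  *-scale a f g n = R.trans
    (sum-cong-≋ {suc n} λ i → R.*-assoc a (f (toℕ i)) (g (n ∸ toℕ i)))
    (R.sym (*-distribˡ-sum {suc n} a (λ i → f (toℕ i) R.* g (n ∸ toℕ i))))

  *-assoc : ∀ f g h → (f *ₛ g) *ₛ h ≈ f *ₛ (g *ₛ h)
  *-assoc f g h zero = solve 3
    (λ a b c → (a :* b :+ con 0) :* c :+ con 0 := a :* (b :* c :+ con 0) :+ con 0) R.refl _ _ _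
  *-assoc f g h (suc n) = begin
    (f 0 R.* g 0 R.+ R.0#) R.* h (suc n) R.+ (tail (f *ₛ g) *ₛ h) n
      -- By definition `tail (f *ₛ g)` is `f 0` times `tail g` plus `tail f *ₛ g`.
      ≈⟨ R.+-congˡ (*-distribʳ h (λ k → f 0 R.* g (suc k)) (tail f *ₛ g) n) ⟩
    (f 0 R.* g 0 R.+ R.0#) R.* h (suc n) R.+
      (((λ k → f 0 R.* g (suc k)) *ₛ h) n R.+ ((tail f *ₛ g) *ₛ h) n)
      ≈⟨ R.+-congˡ (R.+-cong (*-scale (f 0) (tail g) h n) (*-assoc (tail f) g h n)) ⟩
    (f 0 R.* g 0 R.+ R.0#) R.* h (suc n) R.+
      (f 0 R.* (tail g *ₛ h) n R.+ (tail f *ₛ (g *ₛ h)) n)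
      ≈⟨ solve 5 (λ a b c d e → (a :* b :+ con 0) :* c :+ (a :* d :+ e)
                             := a :* (b :* c :+ d) :+ e) R.refl _ _ _ _ _ ⟩
    f 0 R.* (g *ₛ h) (suc n) R.+ (tail f *ₛ (g *ₛ h)) n ∎

  isCommutativeRing : IsCommutativeRing _≈_ P._+_ _*ₛ_ P.-_ P.0# P.1#
  isCommutativeRing = record
    { isRing = record
      { +-isAbelianGroup = record
        { isGroup = record
          { isMonoid = record
            { isSemigroup = record
              { isMagma = record
                { isEquivalence = record
                  { refl  = λ _ → R.refl
                  ; sym   = λ p n → R.sym (p n)
                  ; trans = λ p q n → R.trans (p n) (q n)
                  }
                ; ∙-cong = λ p q n → R.+-cong (p n) (q n)
                }
              ; assoc = λ f g h n → R.+-assoc (f n) (g n) (h n)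
              }
            ; identity = (λ f n → R.+-identityˡ (f n)) , (λ f n → R.+-identityʳ (f n))
            }
          ; inverse = (λ f n → R.-‿inverseˡ (f n)) , (λ f n → R.-‿inverseʳ (f n))
          ; ⁻¹-cong = λ p n → R.-‿cong (p n)
          }
        ; comm = λ f g n → R.+-comm (f n) (g n)
        }
      ; *-cong = λ {f} {f′} → *-cong {f} {f′}
      ; *-assoc = *-assoc
      ; *-identity = *-identityˡ , λ f n → R.trans (*-comm f P.1# n) (*-identityˡ f n)
      ; distrib = *-distribˡ , *-distribʳ
      }
    ; *-comm = *-comm
    }

  commutativeRing : CommutativeRing 0ℓ 0ℓ
  commutativeRing = record { isCommutativeRing = isCommutativeRing }

  z*-zero : ∀ f → (P.z *ₛ f) 0 R.≈ R.0#
  z*-zero f = R.trans (R.+-identityʳ _) (R.zeroˡ _)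

  z*-suc : ∀ f n → (P.z *ₛ f) (suc n) R.≈ f n
  z*-suc f n = R.trans (R.+-cong (R.zeroˡ _)
      (R.trans (*-constant R.1# {tail P.z} {f} R.refl (λ _ → R.refl) n) (R.*-identityˡ _)))
    (R.+-identityˡ _)

  constant-* : ∀ a f n → (P.constant a *ₛ f) n R.≈ a R.* f n
  constant-* a f = *-constant a {P.constant a} {f} R.refl (λ _ → R.refl)

  -- The vector lists coefficients in descending order, which is the order in which the second
  -- factor of a convolution runs.
  lookup-inverseCoeffs : ∀ f n i → lookup (P.inverseCoeffs f n) i ≡ (f P.⁻¹) (n ∸ toℕ i)
  lookup-inverseCoeffs f zero    Fin.zero    = ≡.refl
  lookup-inverseCoeffs f (suc n) Fin.zero    = ≡.refl
  lookup-inverseCoeffs f (suc n) (Fin.suc i) = lookup-inverseCoeffs f n i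

  ⁻¹-inverseʳ : ∀ f → f 0 R.≈ R.1# → f *ₛ (f P.⁻¹) ≈ P.1#
  ⁻¹-inverseʳ f f0≈1 zero =
    R.trans (R.+-identityʳ _) (R.trans (R.*-identityʳ _) f0≈1)
  ⁻¹-inverseʳ f f0≈1 (suc n) = begin
    f 0 R.* (f P.⁻¹) (suc n) R.+ (tail f *ₛ (f P.⁻¹)) n
      ≈⟨ R.+-cong (R.trans (R.*-congʳ f0≈1) (R.*-identityˡ _))
           (sum-cong-≋ {suc n} λ i →
             R.*-congˡ {f (suc (toℕ i))} (R.reflexive (≡.sym (lookup-inverseCoeffs f n i)))) ⟩
    R.- x R.+ x ≈⟨ R.-‿inverseˡ x ⟩
    R.0#        ∎
    where
      x : R.Carrier
      x = SemiringSum.sum R.semiring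
        (λ i → f (suc (toℕ i)) R.* lookup (P.inverseCoeffs f n) i)

  lookup-sqrtCoeffs : ∀ f n i → lookup (P.sqrtCoeffs f n) i ≡ P.sqrt f (suc (n ∸ toℕ i))
  lookup-sqrtCoeffs f zero    Fin.zero    = ≡.refl
  lookup-sqrtCoeffs f (suc n) Fin.zero    = ≡.refl
  lookup-sqrtCoeffs f (suc n) (Fin.suc i) = lookup-sqrtCoeffs f n i

  lookup-sqrtCoeffs-opposite : ∀ f n i →
    lookup (P.sqrtCoeffs f n) (opposite i) ≡ P.sqrt f (suc (toℕ i))
  lookup-sqrtCoeffs-opposite f n i = ≡.trans (lookup-sqrtCoeffs f n (opposite i))
    (≡.cong (P.sqrt f ∘ suc) (≡.trans (≡.cong (n ∸_) (Finₚ.opposite-prop i))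
      (ℕₚ.m∸[m∸n]≡n (ℕₚ.<⇒≤pred (Finₚ.toℕ<n i)))))

  module Halving (½+½≈1 : ½# R.+ ½# R.≈ R.1#) where

    double-half : ∀ a → ½# R.* a R.+ ½# R.* a R.≈ a
    double-half a = R.trans (R.sym (R.distribʳ a ½# ½#))
      (R.trans (R.*-congʳ ½+½≈1) (R.*-identityˡ a))

    -- With `sqrt f` = 1 + z h, coefficient n + 2 of the square is 2 hₙ₊₁ + (h²)ₙ, and the recursion
    -- for h solves exactly this equation. Coefficients 0 and 1 lie outside the recursion.
    sqrt-square : ∀ f → f 0 R.≈ R.1# → P.sqrt f *ₛ P.sqrt f ≈ f
    sqrt-square f f0≈1 zero =
      R.trans (R.+-identityʳ _) (R.trans (R.*-identityˡ _) (R.sym f0≈1))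
    sqrt-square f f0≈1 (suc zero) = R.trans
      (solve 1 (λ a → con 1 :* a :+ (a :* con 1 :+ con 0) := a :+ a) R.refl _)
      (double-half (f 1))
    sqrt-square f f0≈1 (suc (suc n)) = begin
      R.1# R.* s (suc (suc n)) R.+ (h *ₛ s) (suc n)
        ≈⟨ R.+-congˡ (*-sucʳ n h s) ⟩
      R.1# R.* s (suc (suc n)) R.+ (s (suc (suc n)) R.* R.1# R.+ (h *ₛ h) n)
        ≈⟨ solve 2 (λ a b → con 1 :* a :+ (a :* con 1 :+ b) := (a :+ a) :+ b) R.refl _ _ ⟩
      s (suc (suc n)) R.+ s (suc (suc n)) R.+ (h *ₛ h) n
        ≈⟨ R.+-cong (double-half _) hh≈x ⟩
      (f (suc (suc n)) R.+ R.- x) R.+ x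
        ≈⟨ R.+-assoc _ _ _ ⟩
      f (suc (suc n)) R.+ (R.- x R.+ x)
        ≈⟨ R.trans (R.+-congˡ (R.-‿inverseˡ x)) (R.+-identityʳ _) ⟩
      f (suc (suc n)) ∎
      where
        s h : Series
        s = P.sqrt f
        h = tail s

        x : R.Carrier
        x = SemiringSum.sum R.semiring
          (λ i → lookup (P.sqrtCoeffs f n) i R.* lookup (P.sqrtCoeffs f n) (opposite i))

        hh≈x : (h *ₛ h) n R.≈ x
        hh≈x = sum-cong-≋ {suc n} λ i → R.trans (R.*-comm _ _)
          (R.sym (R.*-cong (R.reflexive (lookup-sqrtCoeffs f n i))
                           (R.reflexive (lookup-sqrtCoeffs-opposite f n i))))

    2z*[f/2z] : ∀ f → f 0 R.≈ R.0# → (2 P.· P.z) *ₛ (f P./2z) ≈ f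
    2z*[f/2z] f f0≈0 n = R.trans
      (*-distribʳ (f P./2z) P.z (P.z P.+ P.0#) n)
      (R.trans (R.+-congˡ (*-cong {P.z P.+ P.0#} {P.z} {f P./2z}
          (λ k → R.+-identityʳ (P.z k)) (λ _ → R.refl) n))
        (pointwise n))
      where
        pointwise : ∀ n → (P.z *ₛ (f P./2z)) n R.+ (P.z *ₛ (f P./2z)) n R.≈ f n
        pointwise zero = R.trans (R.+-cong (z*-zero (f P./2z)) (z*-zero (f P./2z)))
          (R.trans (R.+-identityˡ _) (R.sym f0≈0))
        pointwise (suc n) = R.trans (R.+-cong (z*-suc (f P./2z) n) (z*-suc (f P./2z) n))
          (double-half (f (suc n)))

-- The generating functions, from Pascal's rule alone

module GeneratingFunction (R : CommutativeRing 0ℓ 0ℓ) where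

  private
    module R = CommutativeRing R

  module Contiguity
    (½# : R.Carrier) (½+½≈1 : ½# R.+ ½# R.≈ R.1#)
    (τ : R.Carrier) (J : ℕ → ℕ → R.Carrier)
    (J-zeroˡ : ∀ B → J 0 B R.≈ R.1#)
    (J-comm : ∀ A B → J A B R.≈ J B A)
    (J-pascal : ∀ A B → J (suc A) B R.+ (J A (suc B) R.+ τ R.* J A B) R.≈ J (suc A) (suc B) R.+ J A B)
    where

    private
      module P = PowerSeries R.rawRing ½#
      module SR = SeriesRing R ½#
      module S = CommutativeRing SR.commutativeRing
    open SR using (z*-zero; z*-suc; constant-*; ⁻¹-inverseʳ)
    open SR.Halving ½+½≈1
    open P using (Series; z; 1#; _+_; _*_; _-_; _·_; _^_; _≈_; _/2z; _⁻¹)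

    t a radicand Δ q : Series
    t = P.constant τ
    a = 1# + (1# - t) * z
    radicand = a ^ 2 - 4 · z
    Δ = P.sqrt radicand
    q = (a - Δ) /2z

    private
      module RS = NatSolver R.commutativeSemiring
      module SS = NatSolver S.commutativeSemiring
      module RP = RingProperties R.ring
      module SP = RingProperties S.ring

    a-head : a 0 R.≈ R.1#
    a-head = RS.solve 1 (λ x → con 1 :+ (x :* con 0 :+ con 0) := con 1) R.refl _
      where open RS

    radicand-head : radicand 0 R.≈ R.1#
    radicand-head = begin
      radicand 0 ≈⟨ R.+-congʳ (R.+-congʳ (R.*-cong a-head (R.+-congʳ (R.*-congʳ a-head)))) ⟩
      (R.1# R.* (R.1# R.* R.1# R.+ R.0#) R.+ R.0#) R.- (4 · z) 0
        ≈⟨ R.+-cong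
             (RS.solve 0 (con 1 :* (con 1 :* con 1 :+ con 0) :+ con 0 := con 1) R.refl)
             (R.trans (R.-‿cong (RS.solve 0
               (con 0 :+ (con 0 :+ (con 0 :+ (con 0 :+ con 0))) := con 0) R.refl)) RP.-0#≈0#) ⟩
      R.1# R.+ R.0# ≈⟨ R.+-identityʳ _ ⟩
      R.1# ∎
      where
        open RS
        open SetoidReasoning R.setoid

    Δ²≈radicand : Δ * Δ ≈ radicand
    Δ²≈radicand = sqrt-square radicand radicand-head

    2z*q : (2 · z) * q ≈ a - Δ
    2z*q = 2z*[f/2z] (a - Δ) (R.trans (R.+-congʳ a-head) (R.-‿inverseʳ R.1#))

    x-y+y : ∀ x y → (x - y) + y ≈ x
    x-y+y x y = S.trans (S.+-assoc x (P.- y) y)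
      (S.trans (S.+-congˡ (S.-‿inverseˡ y)) (S.+-identityʳ x))

    Δ+2zq≈a : (2 · z) * q + Δ ≈ a
    Δ+2zq≈a = S.trans (S.+-congʳ 2z*q) (x-y+y a Δ)

    halve : ∀ {f g} → f + f ≈ g + g → f ≈ g
    halve {f} {g} p n = R.trans (R.sym (double (f n))) (R.trans (R.*-congˡ (p n)) (double (g n)))
      where
        double : ∀ x → ½# R.* (x R.+ x) R.≈ x
        double x = R.trans (R.distribˡ ½# x x) (double-half x)

    -- Multiplication by z is a shift, so coefficient n can be read off at n + 1. Together with
    -- `halve` this allows division by 4z over any ring with ½.
    z*-cancel : ∀ {f g} → z * f ≈ z * g → f ≈ g
    z*-cancel {f} {g} p n = R.trans (R.sym (z*-suc f n)) (R.trans (p (suc n)) (z*-suc g n))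

    4z*-cancel : ∀ {f g} → (4 · z) * f ≈ (4 · z) * g → f ≈ g
    4z*-cancel {f} {g} p = z*-cancel (halve (halve (begin
      (z * f + z * f) + (z * f + z * f) ≈⟨ 4z*f f ⟩
      (4 · z) * f                       ≈⟨ p ⟩
      (4 · z) * g                       ≈⟨ 4z*f g ⟨
      (z * g + z * g) + (z * g + z * g) ∎)))
      where
        open SS
        open SetoidReasoning S.setoid
        4z*f : ∀ f → (z * f + z * f) + (z * f + z * f) ≈ (4 · z) * f
        4z*f f = solve 2 (λ z f → (z :* f :+ z :* f) :+ (z :* f :+ z :* f)
          := (z :+ (z :+ (z :+ (z :+ con 0)))) :* f) S.refl z f

    -- Squaring 2zq + Δ = a and using Δ² = a² − 4z leaves 4z = 4z q (Δ + z q).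
    q[Δ+zq]≈1 : q * (Δ + z * q) ≈ 1#
    q[Δ+zq]≈1 = 4z*-cancel (SP.+-cancelˡ (Δ * Δ) _ _ (begin
      Δ * Δ + (4 · z) * (q * (Δ + z * q))
        ≈⟨ solve 3 (λ d z q → d :* d :+ (z :+ (z :+ (z :+ (z :+ con 0)))) :* (q :* (d :+ z :* q))
             := ((z :+ (z :+ con 0)) :* q :+ d) :* (((z :+ (z :+ con 0)) :* q :+ d) :* con 1))
             S.refl Δ z q ⟩
      ((2 · z) * q + Δ) ^ 2
        ≈⟨ S.*-cong Δ+2zq≈a (S.*-congʳ Δ+2zq≈a) ⟩
      a ^ 2
        ≈⟨ x-y+y (a ^ 2) (4 · z) ⟨
      radicand + 4 · z
        ≈⟨ S.+-cong Δ²≈radicand (S.*-identityʳ (4 · z)) ⟨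
      Δ * Δ + (4 · z) * 1# ∎))
      where
        open SS
        open SetoidReasoning S.setoid

    -- Replacing 1 by q (Δ + z q) makes the left side q (Δ + 2 z q), and the bracket is a.
    q-quadratic : 1# + z * (q * q) ≈ a * q
    q-quadratic = begin
      1# + z * (q * q)                    ≈⟨ S.+-congʳ q[Δ+zq]≈1 ⟨
      q * (Δ + z * q) + z * (q * q)
        ≈⟨ solve 3 (λ d z q → q :* (d :+ z :* q) :+ z :* (q :* q)
             := ((z :+ (z :+ con 0)) :* q :+ d) :* q) S.refl Δ z q ⟩
      ((2 · z) * q + Δ) * q               ≈⟨ S.*-congʳ Δ+2zq≈a ⟩
      a * q                               ∎
      where
        open SS
        open SetoidReasoning S.setoid

    -- The constant terms of the quadratic equation read 1 = a₀ q₀ with a₀ = 1.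
    q-head : q 0 R.≈ R.1#
    q-head = R.trans
      (R.sym (R.trans (R.+-identityʳ _) (R.trans (R.*-congʳ a-head) (R.*-identityˡ _))))
      (R.trans (R.sym (q-quadratic 0))
        (R.trans (R.+-congˡ (z*-zero (q * q))) (R.+-identityʳ _)))

    a+tz≈1+z : a + t * z ≈ 1# + z
    a+tz≈1+z = begin
      1# + (1# + P.- t) * z + t * z
        ≈⟨ solve 3 (λ z m t → con 1 :+ (con 1 :+ m) :* z :+ t :* z
             := con 1 :+ z :+ (m :+ t) :* z) S.refl z (P.- t) t ⟩
      1# + z + (P.- t + t) * z ≈⟨ S.+-congˡ (S.*-congʳ (S.-‿inverseˡ t)) ⟩
      1# + z + P.0# * z        ≈⟨ solve 1 (λ z → con 1 :+ z :+ con 0 :* z := con 1 :+ z) S.refl z ⟩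
      1# + z                   ∎
      where
        open SS
        open SetoidReasoning S.setoid

    -- This is G_κ + z G_{κ+2} = a G_{κ+1} with the part - t z of a moved to the left: free of
    -- subtraction, it is within reach of a semiring solver.
    Contiguous : (ℕ → Series) → Set
    Contiguous G = ∀ κ →
      G κ + z * (G (suc (suc κ)) + t * G (suc κ)) ≈ G (suc κ) + z * G (suc κ)

    module _ {G : ℕ → Series} (contiguous : Contiguous G) where

      contiguous-zero : ∀ κ → G κ 0 R.≈ G (suc κ) 0
      contiguous-zero κ = begin
        G κ 0                                                ≈⟨ R.+-identityʳ _ ⟨
        G κ 0 R.+ R.0#                                       ≈⟨ R.+-congˡ (z*-zero (G (suc (suc κ)) + t * G (suc κ))) ⟨
        (G κ + z * (G (suc (suc κ)) + t * G (suc κ))) 0       ≈⟨ contiguous κ 0 ⟩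
        (G (suc κ) + z * G (suc κ)) 0                        ≈⟨ R.+-congˡ (z*-zero (G (suc κ))) ⟩
        G (suc κ) 0 R.+ R.0#                                 ≈⟨ R.+-identityʳ _ ⟩
        G (suc κ) 0                                          ∎
        where open SetoidReasoning R.setoid

      contiguous-suc : ∀ κ n → G κ (suc n) R.+ (G (suc (suc κ)) n R.+ τ R.* G (suc κ) n) R.≈
                               G (suc κ) (suc n) R.+ G (suc κ) n
      contiguous-suc κ n = begin
        G κ (suc n) R.+ (G (suc (suc κ)) n R.+ τ R.* G (suc κ) n)
          ≈⟨ R.+-congˡ (R.trans (z*-suc (G (suc (suc κ)) + t * G (suc κ)) n)
               (R.+-congˡ (constant-* τ (G (suc κ)) n))) ⟨
        (G κ + z * (G (suc (suc κ)) + t * G (suc κ))) (suc n) ≈⟨ contiguous κ (suc n) ⟩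
        (G (suc κ) + z * G (suc κ)) (suc n)                  ≈⟨ R.+-congˡ (z*-suc (G (suc κ)) n) ⟩
        G (suc κ) (suc n) R.+ G (suc κ) n                    ∎
        where open SetoidReasoning R.setoid

    -- Induction on n outside and κ inside: coefficient n + 1 at κ + 1 needs coefficient n at κ + 1
    -- and κ + 2, so the hypothesis for n must cover all κ.
    contiguous-unique : ∀ {G H} → Contiguous G → Contiguous H → G 0 ≈ H 0 → ∀ n κ → G κ n R.≈ H κ n
    contiguous-unique cG cH G₀≈H₀ n       zero    = G₀≈H₀ n
    contiguous-unique cG cH G₀≈H₀ zero    (suc κ) =
      R.trans (R.sym (contiguous-zero cG κ))
        (R.trans (contiguous-unique cG cH G₀≈H₀ zero κ) (contiguous-zero cH κ))
    contiguous-unique {G} {H} cG cH G₀≈H₀ (suc n) (suc κ) = RP.+-cancelʳ (G (suc κ) n) _ _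
      (R.trans (R.sym (contiguous-suc cG κ n))
        (R.trans (R.+-cong (contiguous-unique cG cH G₀≈H₀ (suc n) κ)
                   (R.+-cong (below (suc (suc κ))) (R.*-congˡ (below (suc κ)))))
          (R.trans (contiguous-suc cH κ n) (R.+-congˡ (R.sym (below (suc κ)))))))
      where
        below : ∀ κ → G κ n R.≈ H κ n
        below = contiguous-unique cG cH G₀≈H₀ n

    F : ℕ → Series
    F κ n = J n (n ℕ.+ κ)

    F-contiguous : Contiguous F
    F-contiguous κ zero = R.+-cong (R.trans (J-zeroˡ _) (R.sym (J-zeroˡ _)))
      (R.trans (z*-zero (F (suc (suc κ)) + t * F (suc κ))) (R.sym (z*-zero (F (suc κ)))))
    F-contiguous κ (suc n) = R.trans
      (R.+-congˡ (R.trans (z*-suc (F (suc (suc κ)) + t * F (suc κ)) n) (R.+-congˡ (constant-* τ (F (suc κ)) n))))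
      (R.trans pascal (R.+-congˡ (R.sym (z*-suc (F (suc κ)) n))))
      where
        pascal : F κ (suc n) R.+ (F (suc (suc κ)) n R.+ τ R.* F (suc κ) n) R.≈
                 F (suc κ) (suc n) R.+ F (suc κ) n
        -- Pascal's rule at A = n, B = n + κ + 1; the rewrites move the successors out of the second
        -- arguments.
        pascal rewrite ℕₚ.+-suc n (suc κ) | ℕₚ.+-suc n κ = J-pascal n (suc (n ℕ.+ κ))

    -- After division by F₀ q^κ the claim is 1 + z q² + t z q = q (1 + z), which is the quadratic
    -- equation combined with a + t z = 1 + z.
    powers-contiguous : Contiguous (λ κ → F 0 * q ^ κ)
    powers-contiguous κ = begin
      f * p + z * (f * (q * (q * p)) + t * (f * (q * p)))
        ≈⟨ solve 5 (λ f p z q t → f :* p :+ z :* (f :* (q :* (q :* p)) :+ t :* (f :* (q :* p)))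
             := f :* p :* (con 1 :+ z :* (q :* q) :+ t :* z :* q)) S.refl f p z q t ⟩
      f * p * (1# + z * (q * q) + t * z * q)
        ≈⟨ S.*-congˡ {f * p} (S.+-congʳ q-quadratic) ⟩
      f * p * (a * q + t * z * q)
        ≈⟨ solve 6 (λ f p a q t z → f :* p :* (a :* q :+ t :* z :* q)
             := (f :* (q :* p)) :* (a :+ t :* z)) S.refl f p a q t z ⟩
      (f * (q * p)) * (a + t * z)
        ≈⟨ S.*-congˡ {f * (q * p)} a+tz≈1+z ⟩
      (f * (q * p)) * (1# + z)
        ≈⟨ solve 2 (λ g z → g :* (con 1 :+ z) := g :+ z :* g) S.refl (f * (q * p)) z ⟩
      f * (q * p) + z * (f * (q * p)) ∎
      where
        open SS
        open SetoidReasoning S.setoid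
        f p : Series
        f = F 0
        p = q ^ κ

    F≈F₀*q^κ : ∀ κ → F κ ≈ F 0 * q ^ κ
    F≈F₀*q^κ κ n = contiguous-unique F-contiguous powers-contiguous
      (S.sym {F 0 * 1#} (S.*-identityʳ (F 0))) n κ

    -- Pascal's rule at A = B = n governs coefficient n + 1 only. The summand 1 supplies coefficient
    -- 0, where the multiples of z vanish.
    F₀-symmetric : F 0 + z * F 0 ≈ z * (t * F 0 + (F 1 + F 1)) + 1#
    F₀-symmetric zero = R.trans
      (R.+-cong (J-zeroˡ 0) (z*-zero (F 0)))
      (R.trans (R.+-comm _ _) (R.+-congʳ (R.sym (z*-zero (t * F 0 + (F 1 + F 1))))))
    F₀-symmetric (suc n) = begin
      F 0 (suc n) R.+ (z * F 0) (suc n)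
        ≈⟨ R.+-congˡ (z*-suc (F 0) n) ⟩
      J (suc n) (suc n ℕ.+ 0) R.+ J n (n ℕ.+ 0)
        ≡⟨ ≡.cong (λ m → J (suc n) (suc m) R.+ J n m) (ℕₚ.+-identityʳ n) ⟩
      J (suc n) (suc n) R.+ J n n
        ≈⟨ J-pascal n n ⟨
      J (suc n) n R.+ (J n (suc n) R.+ τ R.* J n n)
        ≈⟨ R.+-congʳ (J-comm (suc n) n) ⟩
      J n (suc n) R.+ (J n (suc n) R.+ τ R.* J n n)
        ≈⟨ RS.solve 2 (λ x y → x :+ (x :+ y) := (y :+ (x :+ x)) :+ con 0) R.refl _ _ ⟩
      τ R.* J n n R.+ (J n (suc n) R.+ J n (suc n)) R.+ R.0#
        ≡⟨ ≡.cong₂ (λ m m′ → τ R.* J n m R.+ (J n m′ R.+ J n m′) R.+ R.0#)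
             (ℕₚ.+-identityʳ n) (ℕₚ.+-comm n 1) ⟨
      τ R.* F 0 n R.+ (F 1 n R.+ F 1 n) R.+ R.0#
        ≈⟨ R.+-congʳ (R.trans (z*-suc (t * F 0 + (F 1 + F 1)) n) (R.+-congʳ (constant-* τ (F 0) n))) ⟨
      (z * (t * F 0 + (F 1 + F 1)) + 1#) (suc n) ∎
      where
        open RS
        open SetoidReasoning R.setoid

    Δ*F₀≈1 : Δ * F 0 ≈ 1#
    -- The added terms complete Δ F₀ to (a + t z) F₀ = (1 + z) F₀, the left side of the symmetric
    -- relation.
    Δ*F₀≈1 = SP.+-cancelˡ (t * z * f + (2 · z) * q * f) _ _ (begin
      t * z * f + (2 · z) * q * f + Δ * f
        ≈⟨ solve 4 (λ tz zq f d → tz :* f :+ zq :* f :+ d :* f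
             := ((zq :+ d) :+ tz) :* f) S.refl (t * z) ((2 · z) * q) f Δ ⟩
      ((2 · z) * q + Δ + t * z) * f
        ≈⟨ S.*-congʳ (S.trans (S.+-congʳ Δ+2zq≈a) a+tz≈1+z) ⟩
      (1# + z) * f
        ≈⟨ solve 2 (λ z f → (con 1 :+ z) :* f := f :+ z :* f) S.refl z f ⟩
      f + z * f
        ≈⟨ F₀-symmetric ⟩
      z * (t * f + (F 1 + F 1)) + 1#
        ≈⟨ S.+-congʳ (S.*-congˡ {z} (S.+-congˡ {t * f} (S.+-cong (F≈F₀*q^κ 1) (F≈F₀*q^κ 1)))) ⟩
      z * (t * f + (f * (q * 1#) + f * (q * 1#))) + 1#
        ≈⟨ solve 4 (λ t z f q → z :* (t :* f :+ (f :* (q :* con 1) :+ f :* (q :* con 1))) :+ con 1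
             := (t :* z :* f :+ (z :+ (z :+ con 0)) :* q :* f) :+ con 1) S.refl t z f q ⟩
      t * z * f + (2 · z) * q * f + 1# ∎)
      where
        open SS
        open SetoidReasoning S.setoid
        f : Series
        f = F 0

    F≈Δ⁻¹*q^κ : ∀ κ → F κ ≈ Δ ⁻¹ * q ^ κ
    F≈Δ⁻¹*q^κ κ = begin
      F κ                   ≈⟨ F≈F₀*q^κ κ ⟩
      F 0 * q ^ κ           ≈⟨ S.*-congʳ F₀≈Δ⁻¹ ⟩
      Δ ⁻¹ * q ^ κ          ∎
      where
        open SetoidReasoning S.setoid

        F₀≈Δ⁻¹ : F 0 ≈ Δ ⁻¹
        F₀≈Δ⁻¹ = begin
          F 0                ≈⟨ S.*-identityʳ (F 0) ⟨
          F 0 * 1#           ≈⟨ S.*-congˡ {F 0} (⁻¹-inverseʳ Δ R.refl) ⟨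
          F 0 * (Δ * Δ ⁻¹)   ≈⟨ S.*-assoc (F 0) Δ (Δ ⁻¹) ⟨
          F 0 * Δ * Δ ⁻¹     ≈⟨ S.*-congʳ (S.trans {F 0 * Δ} (S.*-comm (F 0) Δ) Δ*F₀≈1) ⟩
          1# * Δ ⁻¹          ≈⟨ S.*-identityˡ (Δ ⁻¹) ⟩
          Δ ⁻¹               ∎

-- The commutative ring ℚ[t]

module ℚSeries = PowerSeries ℚ.+-*-rawRing ½
module ℚSeriesRing = SeriesRing ℚₚ.+-*-commutativeRing ½

open Polynomial using (Poly; coeff; _≈ₚ_; _+ₚ_; _*ₚ_)

coeff-+ : ∀ p q k → coeff (p +ₚ q) k ≡ coeff p k ℚ.+ coeff q k
coeff-+ []      q       k       = sym (ℚₚ.+-identityˡ (coeff q k))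
coeff-+ (a ∷ p) []      k       = sym (ℚₚ.+-identityʳ (coeff (a ∷ p) k))
coeff-+ (a ∷ p) (b ∷ q) zero    = refl
coeff-+ (a ∷ p) (b ∷ q) (suc k) = coeff-+ p q k

coeff-map : ∀ {f : ℚ → ℚ} → f 0ℚ ≡ 0ℚ → ∀ p k → coeff (map f p) k ≡ f (coeff p k)
coeff-map f0 []      k       = sym f0
coeff-map f0 (a ∷ p) zero    = refl
coeff-map f0 (a ∷ p) (suc k) = coeff-map f0 p k

coeff-* : ∀ p q k → coeff (p *ₚ q) k ≡ (coeff p ℚSeries.*ₛ coeff q) k
coeff-* []      q k = sym (ℚSeriesRing.*-zeroˡ {coeff []} (λ _ → refl) (coeff q) k)
coeff-* (a ∷ p) q k = trans (coeff-+ (map (a ℚ.*_) q) (0ℚ ∷ (p *ₚ q)) k)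
  (trans (cong (ℚ._+ coeff (0ℚ ∷ (p *ₚ q)) k) (coeff-map (ℚₚ.*-zeroʳ a) q k)) (shifted k))
  where
    shifted : ∀ k → a ℚ.* coeff q k ℚ.+ coeff (0ℚ ∷ (p *ₚ q)) k ≡ (coeff (a ∷ p) ℚSeries.*ₛ coeff q) k
    shifted zero    = refl
    shifted (suc k) = cong (λ x → a ℚ.* coeff q (suc k) ℚ.+ x) (coeff-* p q k)

coeff-1 : ∀ k → coeff (1ℚ ∷ []) k ≡ ℚSeries.1# k
coeff-1 zero    = refl
coeff-1 (suc k) = refl

-- Equality of polynomials is by definition equality of their coefficient series, so `coeff` is
-- injective for free and the ring laws are inherited from ℚ⟦z⟧.
coeff-isRingMonomorphism : IsRingMonomorphism Polynomial.rawRing ℚSeries.rawRing coeff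
coeff-isRingMonomorphism = record
  { isRingHomomorphism = record
    { isSemiringHomomorphism = record
      { isNearSemiringHomomorphism = record
        { +-isMonoidHomomorphism = record
          { isMagmaHomomorphism = record
            { isRelHomomorphism = record { cong = λ p → p }
            ; homo = coeff-+
            }
          ; ε-homo = λ _ → refl
          }
        ; *-homo = coeff-*
        }
      ; 1#-homo = coeff-1
      }
    ; -‿homo = coeff-map refl
    }
  ; injective = λ p → p
  }

polyRing : CommutativeRing 0ℓ 0ℓ
polyRing = record
  { isCommutativeRing = RingMonomorphism.isCommutativeRing coeff-isRingMonomorphism
      ℚSeriesRing.isCommutativeRing
  }

-- Pascal's rule for J

ι : ℕ → ℚ
ι k = + k / 1

private
  module ℚM = SemiringMult (CommutativeRing.semiring ℚₚ.+-*-commutativeRing)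

ι≡× : ∀ k → k ℚM.× 1ℚ ≡ ι k
-- The mesh of index 0 is 1.
ι≡× k = Rational.multiple-mesh k 0

ι-+ : ∀ m n → ι (m ℕ.+ n) ≡ ι m ℚ.+ ι n
ι-+ m n = trans (sym (ι≡× (m ℕ.+ n)))
  (trans (ℚM.×-homo-+ 1ℚ m n) (cong₂ ℚ._+_ (ι≡× m) (ι≡× n)))

ι-* : ∀ m n → ι (m ℕ.* n) ≡ ι m ℚ.* ι n
ι-* m n = trans (sym (ι≡× (m ℕ.* n)))
  (trans (ℚM.×1-homo-* m n) (cong₂ ℚ._*_ (ι≡× m) (ι≡× n)))

C·C : ℕ → ℕ → ℕ → ℕ
C·C A B k = (A C k) ℕ.* (B C k)

coeff-applyUpTo : ∀ (f : ℕ → ℚ) n → (∀ k → n ℕ.≤ k → f k ≡ 0ℚ) → ∀ k → coeff (applyUpTo f n) k ≡ f k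
coeff-applyUpTo f zero    f≡0 k       = sym (f≡0 k ℕ.z≤n)
coeff-applyUpTo f (suc n) f≡0 zero    = refl
coeff-applyUpTo f (suc n) f≡0 (suc k) =
  coeff-applyUpTo (f ∘ suc) n (λ k n≤k → f≡0 (suc k) (ℕ.s≤s n≤k)) k

coeff-J : ∀ A B k → coeff (J A B) k ≡ ι (C·C A B k)
coeff-J A B = coeff-applyUpTo (ι ∘ C·C A B) (suc A) λ k A<k →
  cong (λ x → ι (x ℕ.* (B C k))) (k>n⇒nCk≡0 A<k)

-- With a, a′ and b, b′ the neighbouring entries of rows A and B, both sides expand to a b + a b′ +
-- a′ b + 2 a′ b′.
pascal-product : ∀ A B k →
  C·C (suc A) B (suc k) ℕ.+ (C·C A (suc B) (suc k) ℕ.+ C·C A B k) ≡ C·C (suc A) (suc B) (suc k) ℕ.+ C·C A B (suc k)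
pascal-product A B k rewrite sym (nCk+nC[k+1]≡[n+1]C[k+1] A k) | sym (nCk+nC[k+1]≡[n+1]C[k+1] B k) =
  solve 4 (λ a a′ b b′ → (a :+ a′) :* b′ :+ (a′ :* (b :+ b′) :+ a :* b)
    := (a :+ a′) :* (b :+ b′) :+ a′ :* b′) refl (A C k) (A C suc k) (B C k) (B C suc k)
  where open ℕSolver.+-*-Solver

coeff-t*-suc : ∀ p k → coeff (Polynomial.indeterminate *ₚ p) (suc k) ≡ coeff p k
coeff-t*-suc p k = begin
  coeff (Polynomial.indeterminate *ₚ p) (suc k)
    ≡⟨ coeff-* Polynomial.indeterminate p (suc k) ⟩
  (coeff Polynomial.indeterminate ℚSeries.*ₛ coeff p) (suc k)
    ≡⟨ ℚSeriesRing.*-cong {coeff Polynomial.indeterminate} {ℚSeries.z} {coeff p}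
         (λ { zero → refl ; (suc zero) → refl ; (suc (suc _)) → refl }) (λ _ → refl) (suc k) ⟩
  (ℚSeries.z ℚSeries.*ₛ coeff p) (suc k)
    ≡⟨ ℚSeriesRing.z*-suc (coeff p) k ⟩
  coeff p k ∎
  where open ≡-Reasoning

J-zeroˡ : ∀ B → J 0 B ≈ₚ Polynomial.constant 1ℚ
J-zeroˡ B zero    = refl
J-zeroˡ B (suc k) = refl

J-comm : ∀ A B → J A B ≈ₚ J B A
J-comm A B k = trans (coeff-J A B k)
  (trans (cong ι (ℕₚ.*-comm (A C k) (B C k))) (sym (coeff-J B A k)))

J-pascal : ∀ A B →
  J (suc A) B +ₚ (J A (suc B) +ₚ Polynomial.indeterminate *ₚ J A B) ≈ₚ J (suc A) (suc B) +ₚ J A B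
J-pascal A B k = begin
  coeff (J (suc A) B +ₚ (J A (suc B) +ₚ tJ)) k
    ≡⟨ trans (coeff-+ (J (suc A) B) (J A (suc B) +ₚ tJ) k) (cong₂ ℚ._+_ (coeff-J (suc A) B k)
         (trans (coeff-+ (J A (suc B)) tJ k) (cong (ℚ._+ coeff tJ k) (coeff-J A (suc B) k)))) ⟩
  ι (C·C (suc A) B k) ℚ.+ (ι (C·C A (suc B) k) ℚ.+ coeff tJ k)
    ≡⟨ pointwise k ⟩
  ι (C·C (suc A) (suc B) k ℕ.+ C·C A B k)
    ≡⟨ ι-+ (C·C (suc A) (suc B) k) (C·C A B k) ⟩
  ι (C·C (suc A) (suc B) k) ℚ.+ ι (C·C A B k)
    ≡⟨ trans (coeff-+ (J (suc A) (suc B)) (J A B) k)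
         (cong₂ ℚ._+_ (coeff-J (suc A) (suc B) k) (coeff-J A B k)) ⟨
  coeff (J (suc A) (suc B) +ₚ J A B) k ∎
  where
    open ≡-Reasoning

    tJ : Poly
    tJ = Polynomial.indeterminate *ₚ J A B

    pointwise : ∀ k → ι (C·C (suc A) B k) ℚ.+ (ι (C·C A (suc B) k) ℚ.+ coeff tJ k) ≡
                      ι (C·C (suc A) (suc B) k ℕ.+ C·C A B k)
    pointwise zero    = refl
    pointwise (suc k) = begin
      ι (C·C (suc A) B (suc k)) ℚ.+ (ι (C·C A (suc B) (suc k)) ℚ.+ coeff tJ (suc k))
        ≡⟨ cong (λ x → ι (C·C (suc A) B (suc k)) ℚ.+ (ι (C·C A (suc B) (suc k)) ℚ.+ x))
             (trans (coeff-t*-suc (J A B) k) (coeff-J A B k)) ⟩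
      ι (C·C (suc A) B (suc k)) ℚ.+ (ι (C·C A (suc B) (suc k)) ℚ.+ ι (C·C A B k))
        ≡⟨ cong (λ x → ι (C·C (suc A) B (suc k)) ℚ.+ x) (ι-+ (C·C A (suc B) (suc k)) (C·C A B k)) ⟨
      ι (C·C (suc A) B (suc k)) ℚ.+ ι (C·C A (suc B) (suc k) ℕ.+ C·C A B k)
        ≡⟨ ι-+ (C·C (suc A) B (suc k)) (C·C A (suc B) (suc k) ℕ.+ C·C A B k) ⟨
      ι (C·C (suc A) B (suc k) ℕ.+ (C·C A (suc B) (suc k) ℕ.+ C·C A B k))
        ≡⟨ cong ι (pascal-product A B k) ⟩
      ι (C·C (suc A) (suc B) (suc k) ℕ.+ C·C A B (suc k)) ∎

½+½≈1 : Polynomial.constant ½ +ₚ Polynomial.constant ½ ≈ₚ Polynomial.constant 1ℚ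
½+½≈1 zero    = refl
½+½≈1 (suc k) = refl

-- At ℚ[t] with τ = t the series Δ and q unfold to those of the statement.
module G = GeneratingFunction.Contiguity polyRing (Polynomial.constant ½) ½+½≈1
  Polynomial.indeterminate J J-zeroˡ J-comm J-pascal

-- The growth rate: inequalities between rationals

module RootLimit where

  open import Data.Rational.Base using (_+_; _*_; -_; _-_; _≤_; _<_; ∣_∣)
  open import Data.Rational.Properties
  open Rational
  open RawSemiringDefs ℚ.+-*-rawSemiring using (_^_)
  open ℚSolver.+-*-Solver using (solve; _:+_; _:*_; _:-_; :-_; _:=_; con)
  open CommutativeSemiringExp (CommutativeRing.commutativeSemiring +-*-commutativeRing)
    using (^-distrib-*; ^-homo-*)

  p+r≡q⇒p≤q : ∀ {p q r} → 0ℚ ≤ r → p + r ≡ q → p ≤ q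
  p+r≡q⇒p≤q {p} 0≤r eq = subst (p ≤_) eq (p≤p+q 0≤r)

  p≤q⇒0≤q-p : ∀ {p q} → p ≤ q → 0ℚ ≤ q - p
  p≤q⇒0≤q-p {p} {q} p≤q = subst (_≤ q - p) (+-inverseʳ p) (+-monoˡ-≤ (- p) p≤q)

  *-nonNeg : ∀ {p q} → 0ℚ ≤ p → 0ℚ ≤ q → 0ℚ ≤ p * q
  *-nonNeg {p} {q} 0≤p 0≤q = subst (_≤ p * q) (*-zeroˡ 0ℚ) (*-mono-≤-nn ≤-refl 0≤q 0≤p 0≤q)

  *-monoˡ : ∀ {p q} r → 0ℚ ≤ r → p ≤ q → r * p ≤ r * q
  *-monoˡ r 0≤r = *-monoˡ-≤-nonNeg r {{ℚ.nonNegative 0≤r}}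

  0≤1 : 0ℚ ≤ 1ℚ
  0≤1 = nonNegative⁻¹ 1ℚ

  square-nonNeg : ∀ p → 0ℚ ≤ p * p
  square-nonNeg p with ≤-total 0ℚ p
  ... | inj₁ 0≤p = *-nonNeg 0≤p 0≤p
  ... | inj₂ p≤0 = subst (0ℚ ≤_) (solve 1 (λ p → (:- p) :* (:- p) := p :* p) refl p)
    (*-nonNeg (neg-antimono-≤ p≤0) (neg-antimono-≤ p≤0))

  ι-nonNeg : ∀ k → 0ℚ ≤ ι k
  ι-nonNeg k = nonNegative⁻¹ (ι k) {{normalize-nonNeg k 1}}

  ι-suc : ∀ k → ι (suc k) ≡ 1ℚ + ι k
  ι-suc k = ι-+ 1 k

  ι-mono : ∀ {m n} → m ℕ.≤ n → ι m ≤ ι n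
  ι-mono {m} {n} m≤n = p+r≡q⇒p≤q (ι-nonNeg (n ℕ.∸ m))
    (trans (sym (ι-+ m (n ℕ.∸ m))) (cong ι (ℕₚ.m+[n∸m]≡n m≤n)))

  -- Finite sums and the Cauchy-Schwarz inequality

  ∑ : ℕ → (ℕ → ℚ) → ℚ
  ∑ zero    f = 0ℚ
  ∑ (suc n) f = f 0 + ∑ n (f ∘ suc)

  ∑-cong : ∀ n {f g} → (∀ k → f k ≡ g k) → ∑ n f ≡ ∑ n g
  ∑-cong zero    f≡g = refl
  ∑-cong (suc n) f≡g = cong₂ _+_ (f≡g 0) (∑-cong n (f≡g ∘ suc))

  ∑-mono : ∀ n {f g} → (∀ k → f k ≤ g k) → ∑ n f ≤ ∑ n g
  ∑-mono zero    f≤g = ≤-refl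
  ∑-mono (suc n) f≤g = +-mono-≤ (f≤g 0) (∑-mono n (f≤g ∘ suc))

  ∑-nonNeg : ∀ n {f} → (∀ k → 0ℚ ≤ f k) → 0ℚ ≤ ∑ n f
  ∑-nonNeg zero    0≤f = ≤-refl
  ∑-nonNeg (suc n) 0≤f = +-nonNeg (0≤f 0) (∑-nonNeg n (0≤f ∘ suc))

  ∑-+ : ∀ n f g → ∑ n (λ k → f k + g k) ≡ ∑ n f + ∑ n g
  ∑-+ zero    f g = refl
  ∑-+ (suc n) f g = trans (cong (λ x → f 0 + g 0 + x) (∑-+ n (f ∘ suc) (g ∘ suc)))
    (solve 4 (λ a b c d → (a :+ b) :+ (c :+ d) := (a :+ c) :+ (b :+ d)) refl
      (f 0) (g 0) (∑ n (f ∘ suc)) (∑ n (g ∘ suc)))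

  ∑-*ˡ : ∀ n a f → ∑ n (λ k → a * f k) ≡ a * ∑ n f
  ∑-*ˡ zero    a f = sym (*-zeroʳ a)
  ∑-*ˡ (suc n) a f = trans (cong (λ x → a * f 0 + x) (∑-*ˡ n a (f ∘ suc))) (sym (*-distribˡ-+ a (f 0) (∑ n (f ∘ suc))))

  ∑-product : ∀ n {f g} → (∀ k → 0ℚ ≤ f k) → (∀ k → 0ℚ ≤ g k) →
    ∑ n (λ k → f k * g k) ≤ ∑ n f * ∑ n g
  ∑-product zero    0≤f 0≤g = ≤-refl
  ∑-product (suc n) {f} {g} 0≤f 0≤g = ≤-trans
    (+-monoʳ-≤ (f 0 * g 0) (∑-product n (0≤f ∘ suc) (0≤g ∘ suc)))
    (p+r≡q⇒p≤q
      (+-nonNeg (*-nonNeg (0≤f 0) (∑-nonNeg n (0≤g ∘ suc))) (*-nonNeg (∑-nonNeg n (0≤f ∘ suc)) (0≤g 0)))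
      (solve 4 (λ a b c d → a :* b :+ c :* d :+ (a :* d :+ c :* b) := (a :+ c) :* (b :+ d)) refl
        (f 0) (g 0) (∑ n (f ∘ suc)) (∑ n (g ∘ suc))))

  -- This is the sum of the inequalities 0 ≤ (a - f k)².
  2a∑f≤na²+∑f² : ∀ n a f → a * ∑ n f + a * ∑ n f ≤ ι n * (a * a) + ∑ n (λ k → f k * f k)
  2a∑f≤na²+∑f² zero    a f = ≤-reflexive
    (solve 1 (λ a → a :* con 0ℚ :+ a :* con 0ℚ := con 0ℚ :* (a :* a) :+ con 0ℚ) refl a)
  2a∑f≤na²+∑f² (suc n) a f rewrite ι-suc n = p+r≡q⇒p≤q
    (+-nonNeg (square-nonNeg (a - f 0)) (p≤q⇒0≤q-p (2a∑f≤na²+∑f² n a (f ∘ suc))))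
    (solve 5 (λ a b F Q N → (a :* (b :+ F) :+ a :* (b :+ F)) :+
        ((a :- b) :* (a :- b) :+ ((N :* (a :* a) :+ Q) :- (a :* F :+ a :* F)))
        := (con 1ℚ :+ N) :* (a :* a) :+ (b :* b :+ Q)) refl
      a (f 0) (∑ n (f ∘ suc)) (∑ n (λ k → f (suc k) * f (suc k))) (ι n))

  -- The case of a constant second vector. In the step, expanding (a + F)² leaves the mixed term 2 a
  -- F to the preceding lemma and F² to the induction hypothesis.
  cauchy-schwarz : ∀ n f → ∑ n f * ∑ n f ≤ ι n * ∑ n (λ k → f k * f k)
  cauchy-schwarz zero    f = ≤-refl
  cauchy-schwarz (suc n) f rewrite ι-suc n = p+r≡q⇒p≤q
    (+-nonNeg (p≤q⇒0≤q-p (2a∑f≤na²+∑f² n (f 0) (f ∘ suc))) (p≤q⇒0≤q-p (cauchy-schwarz n (f ∘ suc))))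
    (solve 4 (λ a F Q N → (a :+ F) :* (a :+ F) :+
        (((N :* (a :* a) :+ Q) :- (a :* F :+ a :* F)) :+ (N :* Q :- F :* F))
        := (con 1ℚ :+ N) :* (a :* a :+ Q)) refl
      (f 0) (∑ n (f ∘ suc)) (∑ n (λ k → f (suc k) * f (suc k))) (ι n))

  -- Truncated binomial sums

  binomialTerm : ℚ → ℕ → ℕ → ℚ
  binomialTerm s B k = ι (B C k) * s ^ k

  binomialTerm-nonNeg : ∀ {s} → 0ℚ ≤ s → ∀ B k → 0ℚ ≤ binomialTerm s B k
  binomialTerm-nonNeg 0≤s B k = *-nonNeg (ι-nonNeg (B C k)) (^-nonNeg k 0≤s)

  ∑-binomial-suc : ∀ s B n →
    ∑ (suc n) (binomialTerm s (suc B)) ≡ ∑ (suc n) (binomialTerm s B) + s * ∑ n (binomialTerm s B)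
  ∑-binomial-suc s B n = begin
    binomialTerm s B 0 + ∑ n (binomialTerm s (suc B) ∘ suc)
      ≡⟨ cong (λ x → binomialTerm s B 0 + x) (begin
        ∑ n (binomialTerm s (suc B) ∘ suc)
          ≡⟨ ∑-cong n pascal ⟩
        ∑ n (λ k → binomialTerm s B (suc k) + s * binomialTerm s B k)
          ≡⟨ ∑-+ n (binomialTerm s B ∘ suc) (λ k → s * binomialTerm s B k) ⟩
        ∑ n (binomialTerm s B ∘ suc) + ∑ n (λ k → s * binomialTerm s B k)
          ≡⟨ cong (λ x → ∑ n (binomialTerm s B ∘ suc) + x) (∑-*ˡ n s (binomialTerm s B)) ⟩
        ∑ n (binomialTerm s B ∘ suc) + s * ∑ n (binomialTerm s B) ∎) ⟩
    binomialTerm s B 0 + (∑ n (binomialTerm s B ∘ suc) + s * ∑ n (binomialTerm s B))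
      ≡⟨ +-assoc (binomialTerm s B 0) (∑ n (binomialTerm s B ∘ suc)) (s * ∑ n (binomialTerm s B)) ⟨
    ∑ (suc n) (binomialTerm s B) + s * ∑ n (binomialTerm s B) ∎
    where
      open ≡-Reasoning

      pascal : ∀ k → binomialTerm s (suc B) (suc k) ≡ binomialTerm s B (suc k) + s * binomialTerm s B k
      pascal k = trans
        (cong (_* s ^ suc k) (trans (cong ι (sym (nCk+nC[k+1]≡[n+1]C[k+1] B k))) (ι-+ (B C k) (B C suc k))))
        (solve 4 (λ a b s x → (a :+ b) :* (s :* x) := b :* (s :* x) :+ s :* (a :* x)) refl
          (ι (B C k)) (ι (B C suc k)) s (s ^ k))

  ∑-binomial-zero : ∀ s n → ∑ (suc n) (binomialTerm s 0) ≡ 1ℚ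
  ∑-binomial-zero s n = cong (λ x → 1ℚ + x) (trans (∑-cong n λ k → *-zeroˡ (s ^ suc k)) (∑-zero n))
    where
      ∑-zero : ∀ n → ∑ n (λ _ → 0ℚ) ≡ 0ℚ
      ∑-zero zero    = refl
      ∑-zero (suc n) = cong (λ x → 0ℚ + x) (∑-zero n)

  [1+s]x : ∀ s x → x + s * x ≡ (1ℚ + s) * x
  [1+s]x s x = solve 2 (λ s x → x :+ s :* x := (con 1ℚ :+ s) :* x) refl s x

  -- Every truncation n is allowed, because in `J A B` the sum over row B stops at k = A, in general
  -- before the row ends.
  ∑-binomial-≤ : ∀ {s} → 0ℚ ≤ s → ∀ B n → ∑ n (binomialTerm s B) ≤ (1ℚ + s) ^ B
  ∑-binomial-≤ {s} 0≤s B       zero    = ^-nonNeg B (+-nonNeg 0≤1 0≤s)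
  ∑-binomial-≤ {s} 0≤s zero    (suc n) = ≤-reflexive (∑-binomial-zero s n)
  ∑-binomial-≤ {s} 0≤s (suc B) (suc n) = subst₂ _≤_ (sym (∑-binomial-suc s B n)) ([1+s]x s ((1ℚ + s) ^ B))
    (+-mono-≤ (∑-binomial-≤ 0≤s B (suc n)) (*-monoˡ s 0≤s (∑-binomial-≤ 0≤s B n)))

  ∑-binomial : ∀ s B n → B ℕ.< n → ∑ n (binomialTerm s B) ≡ (1ℚ + s) ^ B
  ∑-binomial s zero    (suc n) _           = ∑-binomial-zero s n
  ∑-binomial s (suc B) (suc n) (ℕ.s≤s B<n) = trans (∑-binomial-suc s B n)
    (trans (cong₂ (λ x y → x + s * y) (∑-binomial s B (suc n) (ℕₚ.m<n⇒m<1+n B<n)) (∑-binomial s B n B<n))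
      ([1+s]x s ((1ℚ + s) ^ B)))

  C-monoˡ : ∀ n κ k → n C k ℕ.≤ (n ℕ.+ κ) C k
  C-monoˡ n zero    k rewrite ℕₚ.+-identityʳ n = ℕₚ.≤-refl
  C-monoˡ n (suc κ) k rewrite ℕₚ.+-suc n κ = ℕₚ.≤-trans (C-monoˡ n κ k) (step k)
    where
      step : ∀ k → (n ℕ.+ κ) C k ℕ.≤ suc (n ℕ.+ κ) C k
      step zero    = ℕₚ.≤-refl
      step (suc k) = subst ((n ℕ.+ κ) C suc k ℕ.≤_) (nCk+nC[k+1]≡[n+1]C[k+1] (n ℕ.+ κ) k)
        (ℕₚ.m≤n+m ((n ℕ.+ κ) C suc k) ((n ℕ.+ κ) C k))

  -- Values of J at rational points

  eval : Polynomial.Poly → ℚ → ℚ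
  eval p x = foldr (λ a v → a + x * v) 0ℚ p

  seq-⟦⟧ : ∀ p x m → Real.seq (Real.⟦ p ⟧ x) m ≡ eval p (Real.seq x m)
  seq-⟦⟧ []      x m = refl
  seq-⟦⟧ (a ∷ p) x m = cong (λ v → a + Real.seq x m * v) (seq-⟦⟧ p x m)

  eval-applyUpTo : ∀ f n x → eval (applyUpTo f n) x ≡ ∑ n (λ k → f k * x ^ k)
  eval-applyUpTo f zero    x = refl
  eval-applyUpTo f (suc n) x = cong₂ _+_ (sym (*-identityʳ (f 0))) (begin
    x * eval (applyUpTo (f ∘ suc) n) x          ≡⟨ cong (x *_) (eval-applyUpTo (f ∘ suc) n x) ⟩
    x * ∑ n (λ k → f (suc k) * x ^ k)           ≡⟨ ∑-*ˡ n x (λ k → f (suc k) * x ^ k) ⟨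
    ∑ n (λ k → x * (f (suc k) * x ^ k))
      ≡⟨ ∑-cong n (λ k → solve 3 (λ x a y → x :* (a :* y) := a :* (x :* y)) refl x (f (suc k)) (x ^ k)) ⟩
    ∑ n (λ k → f (suc k) * x ^ suc k)           ∎)
    where open ≡-Reasoning

  eval-J : ∀ A B x → eval (J A B) x ≡ ∑ (suc A) (λ k → ι (C·C A B k) * x ^ k)
  eval-J A B = eval-applyUpTo (ι ∘ C·C A B) (suc A)

  ∣p^k∣≤q^k : ∀ {p q} k → ∣ p ∣ ≤ q → ∣ p ^ k ∣ ≤ q ^ k
  ∣p^k∣≤q^k zero    ∣p∣≤q = ≤-refl
  ∣p^k∣≤q^k {p} {q} (suc k) ∣p∣≤q = subst (_≤ q ^ suc k) (sym (∣p*q∣≡∣p∣*∣q∣ p (p ^ k)))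
    (*-mono-≤-nn (0≤∣p∣ p) (^-nonNeg k (≤-trans (0≤∣p∣ p) ∣p∣≤q)) ∣p∣≤q (∣p^k∣≤q^k k ∣p∣≤q))

  -- All coefficients are nonnegative. The hypothesis bounds the absolute value of x since an
  -- approximation of t may be negative.
  eval-J-mono : ∀ A B {x y} → ∣ x ∣ ≤ y → eval (J A B) x ≤ eval (J A B) y
  eval-J-mono A B {x} {y} ∣x∣≤y = subst₂ _≤_ (sym (eval-J A B x)) (sym (eval-J A B y))
    (∑-mono (suc A) λ k → *-monoˡ (ι (C·C A B k)) (ι-nonNeg (C·C A B k))
      (≤-trans (p≤∣p∣ (x ^ k)) (∣p^k∣≤q^k k ∣x∣≤y)))

  eval-J-square : ∀ A B s → eval (J A B) (s * s) ≡ ∑ (suc A) (λ k → binomialTerm s A k * binomialTerm s B k)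
  eval-J-square A B s = trans (eval-J A B (s * s)) (∑-cong (suc A) λ k →
    trans (cong₂ _*_ (ι-* (A C k) (B C k)) (^-distrib-* s s k))
      (solve 3 (λ a b x → (a :* b) :* (x :* x) := (a :* x) :* (b :* x)) refl (ι (A C k)) (ι (B C k)) (s ^ k)))

  J-upper : ∀ A B {x s} → 0ℚ ≤ s → ∣ x ∣ ≤ s * s → eval (J A B) x ≤ (1ℚ + s) ^ A * (1ℚ + s) ^ B
  J-upper A B {x} {s} 0≤s ∣x∣≤s² = ≤-trans (eval-J-mono A B ∣x∣≤s²)
    (≤-trans (≤-reflexive (eval-J-square A B s))
      (≤-trans (∑-product (suc A) (binomialTerm-nonNeg 0≤s A) (binomialTerm-nonNeg 0≤s B))
        (*-mono-≤-nn (∑-nonNeg (suc A) (binomialTerm-nonNeg 0≤s A)) (^-nonNeg B (+-nonNeg 0≤1 0≤s))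
          (∑-binomial-≤ 0≤s A (suc A)) (∑-binomial-≤ 0≤s B (suc A)))))

  J-lower : ∀ n κ {x s} → 0ℚ ≤ s → s * s ≤ x →
    (1ℚ + s) ^ n * (1ℚ + s) ^ n ≤ ι (suc n) * eval (J n (n ℕ.+ κ)) x
  J-lower n κ {x} {s} 0≤s s²≤x = begin
    (1ℚ + s) ^ n * (1ℚ + s) ^ n
      ≡⟨ cong₂ _*_ (∑-binomial s n (suc n) ℕₚ.≤-refl) (∑-binomial s n (suc n) ℕₚ.≤-refl) ⟨
    ∑ (suc n) (binomialTerm s n) * ∑ (suc n) (binomialTerm s n)
      ≤⟨ cauchy-schwarz (suc n) (binomialTerm s n) ⟩
    ι (suc n) * ∑ (suc n) (λ k → binomialTerm s n k * binomialTerm s n k)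
      ≤⟨ *-monoˡ (ι (suc n)) (ι-nonNeg (suc n)) (∑-mono (suc n) λ k →
           *-monoˡ (binomialTerm s n k) (binomialTerm-nonNeg 0≤s n k)
             (*-mono-≤-nn (ι-nonNeg (n C k)) (^-nonNeg k 0≤s) (ι-mono (C-monoˡ n κ k)) ≤-refl)) ⟩
    ι (suc n) * ∑ (suc n) (λ k → binomialTerm s n k * binomialTerm s (n ℕ.+ κ) k)
      ≡⟨ cong (ι (suc n) *_) (eval-J-square n (n ℕ.+ κ) s) ⟨
    ι (suc n) * eval (J n (n ℕ.+ κ)) (s * s)
      ≤⟨ *-monoˡ (ι (suc n)) (ι-nonNeg (suc n)) (eval-J-mono n (n ℕ.+ κ)
           (subst (_≤ x) (sym (0≤p⇒∣p∣≡p (*-nonNeg 0≤s 0≤s))) s²≤x)) ⟩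
    ι (suc n) * eval (J n (n ℕ.+ κ)) x ∎
    where open ≤-Reasoning

  -- The bound c is the sum of the absolute values of the coefficients.
  eval-bounded : ∀ p → ∃ λ c → 0ℚ ≤ c × (∀ {x} → ∣ x ∣ ≤ 1ℚ → ∣ eval p x ∣ ≤ c)
  eval-bounded []      = 0ℚ , ≤-refl , λ _ → ≤-refl
  eval-bounded (a ∷ p) with eval-bounded p
  ... | c , 0≤c , bound = ∣ a ∣ + c , +-nonNeg (0≤∣p∣ a) 0≤c , λ {x} ∣x∣≤1 →
    ≤-trans (∣p+q∣≤∣p∣+∣q∣ a (x * eval p x)) (+-monoʳ-≤ ∣ a ∣
      (≤-trans (≤-reflexive (∣p*q∣≡∣p∣*∣q∣ x (eval p x)))
        (≤-trans (*-mono-≤-nn (0≤∣p∣ x) 0≤c ∣x∣≤1 (bound ∣x∣≤1)) (≤-reflexive (*-identityˡ c)))))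

  -- J has constant coefficient 1, so its value is 1 + x r(x) with r bounded on the unit interval
  -- around 0. The constant c depends on n.
  J-near-0 : ∀ n B → ∃ λ c → 0ℚ ≤ c × (∀ {x η} → ∣ x ∣ ≤ η → η ≤ 1ℚ → 1ℚ - c * η ≤ eval (J n B) x)
  J-near-0 n B with eval-bounded (applyUpTo (ι ∘ C·C n B ∘ suc) n)
  ... | c , 0≤c , bound = c , 0≤c , λ {x} {η} ∣x∣≤η η≤1 →
    let r = eval (applyUpTo (ι ∘ C·C n B ∘ suc) n) x
        -xr≤cη : - (x * r) ≤ c * η
        -xr≤cη = ≤-trans (p≤∣p∣ (- (x * r))) (≤-trans
          (≤-reflexive (trans (∣-p∣≡∣p∣ (x * r)) (trans (∣p*q∣≡∣p∣*∣q∣ x r) (*-comm ∣ x ∣ ∣ r ∣))))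
          (*-mono-≤-nn (0≤∣p∣ r) (≤-trans (0≤∣p∣ x) ∣x∣≤η) (bound (≤-trans ∣x∣≤η η≤1)) ∣x∣≤η))
    in +-monoʳ-≤ 1ℚ (subst (- (c * η) ≤_) (solve 1 (λ y → :- (:- y) := y) refl (x * r)) (neg-antimono-≤ -xr≤cη))

  -- Exponential against linear growth

  bernoulli : ∀ {e} → 0ℚ ≤ e → ∀ n → 1ℚ + ι n * e ≤ (1ℚ + e) ^ n
  bernoulli {e} 0≤e zero    = ≤-reflexive (solve 1 (λ e → con 1ℚ :+ con 0ℚ :* e := con 1ℚ) refl e)
  bernoulli {e} 0≤e (suc n) rewrite ι-suc n = ≤-trans
    (p+r≡q⇒p≤q (*-nonNeg (ι-nonNeg n) (*-nonNeg 0≤e 0≤e))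
      (solve 2 (λ N e → con 1ℚ :+ (con 1ℚ :+ N) :* e :+ N :* (e :* e)
        := (con 1ℚ :+ e) :* (con 1ℚ :+ N :* e)) refl (ι n) e))
    (*-monoˡ (1ℚ + e) (+-nonNeg 0≤1 0≤e) (bernoulli 0≤e n))

  -- The left side is the term C(k+1,2) e² of the binomial expansion. Bernoulli's linear bound
  -- cannot dominate K (n + 1) for arbitrary K; this one can.
  quadratic-growth : ∀ {e} → 0ℚ ≤ e → ∀ k → ½ * (ι (suc k) * ι k) * (e * e) ≤ (1ℚ + e) ^ suc k
  quadratic-growth {e} 0≤e zero = ≤-trans
    (≤-reflexive (solve 1 (λ e → con ½ :* (con 1ℚ :* con 0ℚ) :* (e :* e) := con 0ℚ) refl e))
    (^-nonNeg 1 (+-nonNeg 0≤1 0≤e))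
  quadratic-growth {e} 0≤e (suc k) rewrite ι-suc (suc k) | ι-suc k = subst₂ _≤_
    (solve 2 (λ N e → con ½ :* ((con 1ℚ :+ N) :* N) :* (e :* e) :+ e :* ((con 1ℚ :+ N) :* e)
        := con ½ :* ((con 1ℚ :+ (con 1ℚ :+ N)) :* (con 1ℚ :+ N)) :* (e :* e))
        refl (ι k) e)
    (solve 2 (λ e g → g :+ e :* g := (con 1ℚ :+ e) :* g) refl e ((1ℚ + e) ^ suc k))
    (+-mono-≤ (subst (λ M → ½ * (M * ι k) * (e * e) ≤ (1ℚ + e) ^ suc k) (ι-suc k) (quadratic-growth 0≤e k))
      (*-monoˡ e 0≤e (subst (λ M → M * e ≤ (1ℚ + e) ^ suc k) (ι-suc k)
        (≤-trans (p+r≡q⇒p≤q 0≤1 (+-comm (ι (suc k) * e) 1ℚ)) (bernoulli 0≤e (suc k))))))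

  1≤ι*mesh : ∀ m → 1ℚ ≤ ι (suc m) * mesh m
  1≤ι*mesh m = ≤-trans (1≤/ (suc m) m ℕₚ.≤-refl) (≤-reflexive (trans
    (sym (multiple-mesh (suc m) m))
    (trans (cong (suc m ℚM.×_) (sym (*-identityˡ (mesh m))))
      (trans (sym (ℚM.×-assoc-* (suc m) 1ℚ (mesh m))) (cong (_* mesh m) (ι≡× (suc m)))))))

  exponential-beats-linear : ∀ {e K} → 0ℚ < e → 0ℚ < K →
    ∃ λ N → ∀ n → N ℕ.≤ n → K * ι (suc n) ≤ (1ℚ + e) ^ n
  exponential-beats-linear {e} {K} 0<e 0<K = suc (suc M) , λ { _ (ℕ.s≤s (ℕ.s≤s {n = m} M≤m)) → bound m M≤m }
    where
      open ≤-Reasoning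

      -- δ = e² / (4 K): once 1/k ≤ δ, the quadratic term of (1 + e)^(k+1) is at least 2 K (k + 1),
      -- which exceeds K (k + 2).
      shrunk : ∃ λ δ → 0ℚ < δ × (K + K) * δ ≡ ½ * (e * e)
      shrunk = Real.shrink (+-mono-< 0<K 0<K) (*-pos 0<e 0<e)

      δ : ℚ
      δ = proj₁ shrunk

      small : ∃ λ N → ∀ m → N ℕ.≤ m → mesh m ≤ δ
      small = mesh-small (proj₁ (proj₂ shrunk))

      M : ℕ
      M = proj₁ small

      0≤K : 0ℚ ≤ K
      0≤K = <⇒≤ 0<K

      bound : ∀ m → M ℕ.≤ m → K * ι (suc (suc (suc m))) ≤ (1ℚ + e) ^ suc (suc m)
      bound m M≤m = begin
        K * ι (suc (suc k))
          ≡⟨ cong (K *_) (ι-suc (suc k)) ⟩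
        K * (1ℚ + ι (suc k))
          ≤⟨ *-monoˡ K 0≤K (+-monoˡ-≤ (ι (suc k)) (ι-mono {1} {suc k} (ℕ.s≤s ℕ.z≤n))) ⟩
        K * (ι (suc k) + ι (suc k))
          ≡⟨ solve 2 (λ K x → K :* (x :+ x) := (K :+ K) :* x :* con 1ℚ) refl K (ι (suc k)) ⟩
        (K + K) * ι (suc k) * 1ℚ
          ≤⟨ *-monoˡ ((K + K) * ι (suc k)) (*-nonNeg (+-nonNeg 0≤K 0≤K) (ι-nonNeg (suc k)))
               (≤-trans (1≤ι*mesh m) (*-monoˡ (ι k) (ι-nonNeg k) (proj₂ small m M≤m))) ⟩
        (K + K) * ι (suc k) * (ι k * δ)
          ≡⟨ solve 4 (λ K x y d → K :* x :* (y :* d) := K :* d :* (x :* y)) refl (K + K) (ι (suc k)) (ι k) δ ⟩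
        (K + K) * δ * (ι (suc k) * ι k)
          ≡⟨ cong (_* (ι (suc k) * ι k)) (proj₂ (proj₂ shrunk)) ⟩
        ½ * (e * e) * (ι (suc k) * ι k)
          ≡⟨ solve 3 (λ h ee x → h :* ee :* x := h :* x :* ee) refl ½ (e * e) (ι (suc k) * ι k) ⟩
        ½ * (ι (suc k) * ι k) * (e * e)
          ≤⟨ quadratic-growth (<⇒≤ 0<e) k ⟩
        (1ℚ + e) ^ suc k ∎
        where
          k : ℕ
          k = suc m

  -- Comparing n-th roots

  -- Since v (1 + e) ≤ v + W e, a factor (1 + e)^n under an n-th root costs at most ε = W e.
  scaled-power : ∀ {v W e ε} n → 0ℚ ≤ v → v ≤ W → 0ℚ ≤ e → W * e ≡ ε →
    v ^ n * (1ℚ + e) ^ n ≤ (v + ε) ^ n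
  scaled-power {v} {W} {e} {ε} n 0≤v v≤W 0≤e We≡ε = subst (_≤ (v + ε) ^ n) (^-distrib-* v (1ℚ + e) n)
    (^-mono-≤ n (*-nonNeg 0≤v (+-nonNeg 0≤1 0≤e))
      (subst (_≤ v + ε) (solve 2 (λ v e → v :+ v :* e := v :* (con 1ℚ :+ e)) refl v e)
        (+-monoʳ-≤ v (subst (v * e ≤_) We≡ε (*-mono-≤-nn 0≤v 0≤e v≤W ≤-refl)))))

  root-upper : ∀ {u v W L e ε} n → 0ℚ < v → v ≤ W → 0ℚ ≤ e → 0ℚ < ε → W * e ≡ ε →
    u ≡ 0ℚ ⊎ u ^ n ≤ v ^ n * L → L < (1ℚ + e) ^ n → u < v + ε
  root-upper {u} {v} {ε = ε} n 0<v v≤W 0≤e 0<ε We≡ε bound L<gⁿ with u <? v + ε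
  ... | yes u<v+ε = u<v+ε
  -- The value u = 0 is the default of `approxRoot`; it lies below v + ε already.
  ... | no  u≮v+ε = [ (λ { refl → +-mono-< 0<v 0<ε }) , (λ uⁿ≤vⁿL → contradiction
          (<-≤-trans (*-monoʳ-<-pos (v ^ n) {{ℚ.positive (^-pos n 0<v)}} L<gⁿ)
            (≤-trans (scaled-power n (<⇒≤ 0<v) v≤W 0≤e We≡ε)
              (≤-trans (^-mono-≤ n (<⇒≤ (+-mono-< 0<v 0<ε)) (≮⇒≥ u≮v+ε)) uⁿ≤vⁿL)))
          (<-irrefl refl)) ]′ bound

  root-lower : ∀ {v w W a L e ε} n → 0ℚ ≤ v → w ≤ W → 0ℚ ≤ e → 0ℚ < ε → W * e ≡ ε → 0ℚ < L →
    w ^ n ≤ L * a → a < v ^ n → L ≤ (1ℚ + e) ^ n → w < v + ε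
  root-lower {v} {w} {W} {a} {L} {e} {ε} n 0≤v w≤W 0≤e 0<ε We≡ε 0<L wⁿ≤La a<vⁿ L≤gⁿ with w <? v + ε
  ... | yes w<v+ε = w<v+ε
  ... | no  w≮v+ε = contradiction chain (<-irrefl refl)
    where
      open ≤-Reasoning

      v+ε≤w : v + ε ≤ w
      v+ε≤w = ≮⇒≥ w≮v+ε

      chain : v ^ n * (1ℚ + e) ^ n < v ^ n * (1ℚ + e) ^ n
      chain = begin-strict
        -- The bound v ≤ W comes from the assumption v + ε ≤ w being refuted.
        v ^ n * (1ℚ + e) ^ n ≤⟨ scaled-power n 0≤v (≤-trans (p≤p+q (<⇒≤ 0<ε)) (≤-trans v+ε≤w w≤W)) 0≤e We≡ε ⟩
        (v + ε) ^ n          ≤⟨ ^-mono-≤ n (+-nonNeg 0≤v (<⇒≤ 0<ε)) v+ε≤w ⟩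
        w ^ n                ≤⟨ wⁿ≤La ⟩
        L * a                <⟨ *-monoʳ-<-pos L {{ℚ.positive 0<L}} a<vⁿ ⟩
        L * v ^ n            ≡⟨ *-comm L (v ^ n) ⟩
        v ^ n * L            ≤⟨ *-monoˡ (v ^ n) (^-nonNeg n 0≤v) L≤gⁿ ⟩
        v ^ n * (1ℚ + e) ^ n ∎

  -- The estimate at one index of the approximating sequences

  p^n≤p : ∀ {p} n .{{_ : ℕ.NonZero n}} → 0ℚ ≤ p → p ≤ 1ℚ → p ^ n ≤ p
  p^n≤p {p} (suc n) 0≤p p≤1 = subst (p ^ suc n ≤_) (*-identityʳ p) (*-monoˡ p 0≤p (^≤1 n))
    where
      ^≤1 : ∀ n → p ^ n ≤ 1ℚ
      ^≤1 zero    = ≤-refl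
      ^≤1 (suc n) = *-mono-≤-nn 0≤p 0≤1 p≤1 (^≤1 n)

  -- For b ≤ 1 this removes the exponent without extracting a root of b: either a ≤ 1 and a^n ≤ a,
  -- or b ≤ 1 ≤ a.
  b≤a^n⇒b≤a : ∀ {a b} n .{{_ : ℕ.NonZero n}} → 0ℚ ≤ a → b ≤ 1ℚ → b ≤ a ^ n → b ≤ a
  b≤a^n⇒b≤a {a} n 0≤a b≤1 b≤aⁿ with ≤-total a 1ℚ
  ... | inj₁ a≤1 = ≤-trans b≤aⁿ (p^n≤p n 0≤a a≤1)
  ... | inj₂ 1≤a = ≤-trans b≤1 1≤a

  a<b+c⇒a-b<c : ∀ {a b c} → a < b + c → a - b < c
  a<b+c⇒a-b<c {a} {b} {c} a<b+c = subst (a - b <_) (solve 2 (λ b c → (b :+ c) :- b := c) refl b c)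
    (+-monoˡ-< (- b) a<b+c)

  -- Bounds 1 + s + η whenever s² ≤ x < b and η ≤ 1.
  rootBound : ℚ → ℚ
  rootBound b = 1ℚ + ((1ℚ + b) + 1ℚ)

  rootBound-pos : ∀ {b} → 0ℚ < b → 0ℚ < rootBound b
  rootBound-pos 0<b = +-mono-<-≤ (positive⁻¹ 1ℚ) (+-nonNeg (+-nonNeg 0≤1 (<⇒≤ 0<b)) 0≤1)

  -- The estimates behind the limit at one index of the approximating sequences:
  -- x approximates t, s and u the square root of x and the n-th root of a = J(x),
  -- both with mesh μ.

  module RootEstimate
    (n κ : ℕ) .{{_ : ℕ.NonZero n}} {B e ε ε′ η c μ x s u a : ℚ}
    (0<B : 0ℚ < B) (0<e : 0ℚ < e) (0<ε : 0ℚ < ε) (0<ε′ : 0ℚ < ε′) (0<η : 0ℚ < η) (η≤1 : η ≤ 1ℚ)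
    (0≤c : 0ℚ ≤ c) (0<μ : 0ℚ < μ) (μ≤η : μ ≤ η)
    (We≡ε : rootBound B * rootBound B * e ≡ ε)
    (Dη≤½ε′ : ((rootBound B + rootBound B) + (c + 1ℚ)) * η ≤ ½ * ε′)
    (Y₀^κ<gⁿ : rootBound B ^ κ < (1ℚ + e) ^ n) (ι[1+n]≤gⁿ : ι (suc n) ≤ (1ℚ + e) ^ n)
    (x<B : x < B) (-x<η² : - x < η * η)
    (0≤s : 0ℚ ≤ s) (s-lower : s ≡ 0ℚ ⊎ s ^ 2 ≤ x) (s-upper : x < (s + μ) ^ 2)
    (0≤u : 0ℚ ≤ u) (u-lower : u ≡ 0ℚ ⊎ u ^ n ≤ a) (u-upper : a < (u + μ) ^ n)
    (a-upper : ∀ {y} → 0ℚ ≤ y → ∣ x ∣ ≤ y * y → a ≤ (1ℚ + y) ^ n * (1ℚ + y) ^ (n ℕ.+ κ))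
    (a-lower : ∀ {y} → 0ℚ ≤ y → y * y ≤ x → (1ℚ + y) ^ n * (1ℚ + y) ^ n ≤ ι (suc n) * a)
    (a-near-0 : ∣ x ∣ ≤ η → 1ℚ - c * η ≤ a)
    where

    open ≤-Reasoning

    -- w is the value compared with u; v and y are upper estimates of the exact roots of a and of
    -- |x|. W bounds both w and Y². D bounds the two coefficients of η that arise: 2 (1 + s) + η
    -- from Y² - w, and c + 1 from the case x ≤ 0.
    Y₀ W D v w y Y : ℚ
    Y₀ = rootBound B
    W = Y₀ * Y₀
    D = (Y₀ + Y₀) + (c + 1ℚ)
    v = u + μ
    w = (1ℚ + s) * (1ℚ + s)
    y = s + η
    Y = 1ℚ + y

    0<Y₀ : 0ℚ < Y₀
    0<Y₀ = rootBound-pos 0<B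

    0≤2Y₀ : 0ℚ ≤ Y₀ + Y₀
    0≤2Y₀ = +-nonNeg (<⇒≤ 0<Y₀) (<⇒≤ 0<Y₀)

    0≤η : 0ℚ ≤ η
    0≤η = <⇒≤ 0<η

    0≤v : 0ℚ ≤ v
    0≤v = +-nonNeg 0≤u (<⇒≤ 0<μ)

    0≤y : 0ℚ ≤ y
    0≤y = +-nonNeg 0≤s 0≤η

    0<Y : 0ℚ < Y
    0<Y = +-mono-<-≤ (positive⁻¹ 1ℚ) 0≤y

    Dη-bound : ∀ p → p ≤ D → p * η ≤ ½ * ε′
    Dη-bound p p≤D = ≤-trans (*-monoʳ-≤-nonNeg η {{ℚ.nonNegative 0≤η}} p≤D) Dη≤½ε′

    finish : ∀ {a b} → a < b + (½ * ε′ + ε) → a - b < ε + ε′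
    finish {a} {b} a<b+ = <-≤-trans (a<b+c⇒a-b<c {a} {b} a<b+) (p+r≡q⇒p≤q (<⇒≤ (0<½ε 0<ε′))
      (trans (solve 2 (λ h ε → (h :+ ε) :+ h := ε :+ (h :+ h)) refl (½ * ε′) ε) (cong (λ x → ε + x) (½+½ ε′))))

    ^2 : ∀ p → p ^ 2 ≡ p * p
    ^2 p = cong (p *_) (*-identityʳ p)

    s≡0⊎s²≤x : s ≡ 0ℚ ⊎ s * s ≤ x
    s≡0⊎s²≤x = [ inj₁ , (λ s²≤x → inj₂ (subst (_≤ x) (^2 s) s²≤x)) ]′ (s-lower)

    s≤1+B : s ≤ 1ℚ + B
    s≤1+B with s≡0⊎s²≤x | ≤-total s 1ℚ
    ... | inj₁ s≡0  | _        = subst (_≤ 1ℚ + B) (sym s≡0) (+-nonNeg 0≤1 (<⇒≤ 0<B))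
    ... | inj₂ _    | inj₁ s≤1 = ≤-trans s≤1 (p≤p+q (<⇒≤ 0<B))
    ... | inj₂ s²≤x | inj₂ 1≤s = begin
      s      ≡⟨ *-identityʳ s ⟨
      s * 1ℚ ≤⟨ *-monoˡ s 0≤s 1≤s ⟩
      s * s  ≤⟨ s²≤x ⟩
      x      ≤⟨ <⇒≤ x<B ⟩
      B      ≤⟨ p+r≡q⇒p≤q 0≤1 (+-comm B 1ℚ) ⟩
      1ℚ + B ∎

    -- Adding η to s serves both signs: it covers the mesh when x is positive and the excess below 0
    -- when x is negative.
    ∣x∣≤y² : ∣ x ∣ ≤ y * y
    ∣x∣≤y² = <⇒≤ (∣p∣<ε
      (<-≤-trans (s-upper) (subst ((s + μ) ^ 2 ≤_) (^2 y)
        (^-mono-≤ 2 (+-nonNeg 0≤s (<⇒≤ (0<μ))) (+-monoʳ-≤ s μ≤η))))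
      (<-≤-trans -x<η² (*-mono-≤-nn 0≤η 0≤y η≤y η≤y)))
      where
        η≤y : η ≤ y
        η≤y = p+r≡q⇒p≤q 0≤s (+-comm η s)

    Y≤Y₀ : Y ≤ Y₀
    Y≤Y₀ = +-monoʳ-≤ 1ℚ (+-mono-≤ s≤1+B η≤1)

    1+s≤Y₀ : 1ℚ + s ≤ Y₀
    1+s≤Y₀ = ≤-trans (+-monoʳ-≤ 1ℚ (p≤p+q {s} {η} 0≤η)) Y≤Y₀

    a≤Y²ⁿY₀^κ : a ≤ (Y * Y) ^ n * Y₀ ^ κ
    a≤Y²ⁿY₀^κ = begin
      a                      ≤⟨ a-upper 0≤y ∣x∣≤y² ⟩
      Y ^ n * Y ^ (n ℕ.+ κ)    ≡⟨ cong (Y ^ n *_) (^-homo-* Y n κ) ⟩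
      Y ^ n * (Y ^ n * Y ^ κ)  ≡⟨ *-assoc (Y ^ n) (Y ^ n) (Y ^ κ) ⟨
      Y ^ n * Y ^ n * Y ^ κ    ≡⟨ cong (_* Y ^ κ) (^-distrib-* Y Y n) ⟨
      (Y * Y) ^ n * Y ^ κ      ≤⟨ *-monoˡ ((Y * Y) ^ n) (^-nonNeg n (*-nonNeg (<⇒≤ 0<Y) (<⇒≤ 0<Y)))
                                    (^-mono-≤ κ (<⇒≤ 0<Y) Y≤Y₀) ⟩
      (Y * Y) ^ n * Y₀ ^ κ     ∎

    u<Y²+ε : u < Y * Y + ε
    u<Y²+ε = root-upper n (*-pos 0<Y 0<Y) (*-mono-≤-nn (<⇒≤ 0<Y) (<⇒≤ 0<Y₀) Y≤Y₀ Y≤Y₀) (<⇒≤ 0<e) 0<ε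
      We≡ε
      ([ inj₁ , (λ uⁿ≤a → inj₂ (≤-trans uⁿ≤a a≤Y²ⁿY₀^κ)) ]′ (u-lower))
      Y₀^κ<gⁿ

    Y²≤w+½ε′ : Y * Y ≤ w + ½ * ε′
    Y²≤w+½ε′ = subst (_≤ w + ½ * ε′)
      (solve 2 (λ s h → (con 1ℚ :+ s) :* (con 1ℚ :+ s) :+ ((con 1ℚ :+ s) :+ (con 1ℚ :+ s) :+ h) :* h
        := (con 1ℚ :+ (s :+ h)) :* (con 1ℚ :+ (s :+ h))) refl s η)
      (+-monoʳ-≤ w (Dη-bound (1ℚ + s + (1ℚ + s) + η)
        (+-mono-≤ (+-mono-≤ 1+s≤Y₀ 1+s≤Y₀) (≤-trans η≤1 (p+r≡q⇒p≤q 0≤c (+-comm 1ℚ c))))))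

    u-w<ε+ε′ : u - w < ε + ε′
    u-w<ε+ε′ = finish {u} {w} (<-≤-trans u<Y²+ε (subst (Y * Y + ε ≤_) (+-assoc w (½ * ε′) ε)
      (+-monoˡ-≤ ε Y²≤w+½ε′)))

    μ≤½ε′ : μ ≤ ½ * ε′
    μ≤½ε′ = ≤-trans μ≤η (subst (_≤ ½ * ε′) (*-identityˡ η) (Dη-bound 1ℚ
      (p+r≡q⇒p≤q (+-nonNeg 0≤2Y₀ 0≤c)
        (solve 2 (λ a c → con 1ℚ :+ (a :+ c) := a :+ (c :+ con 1ℚ)) refl (Y₀ + Y₀) c))))

    w<u+½ε′+ε-if-s²≤x : s * s ≤ x → w < u + (½ * ε′ + ε)
    w<u+½ε′+ε-if-s²≤x s²≤x = begin-strict
      w                     <⟨ root-lower n 0≤v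
                                 (*-mono-≤-nn (+-nonNeg 0≤1 0≤s) (<⇒≤ 0<Y₀) 1+s≤Y₀ 1+s≤Y₀)
                                 (<⇒≤ 0<e) 0<ε We≡ε
                                 (<-≤-trans (positive⁻¹ 1ℚ) (ι-mono {1} {suc n} (ℕ.s≤s ℕ.z≤n)))
                                 (subst (_≤ ι (suc n) * a) (sym (^-distrib-* (1ℚ + s) (1ℚ + s) n))
                                   (a-lower 0≤s s²≤x))
                                 u-upper ι[1+n]≤gⁿ ⟩
      u + μ + ε        ≤⟨ +-monoˡ-≤ ε (+-monoʳ-≤ u μ≤½ε′) ⟩
      u + ½ * ε′ + ε        ≡⟨ +-assoc u (½ * ε′) ε ⟩
      u + (½ * ε′ + ε)      ∎

    -- Here w = 1, and the Cauchy-Schwarz bound would need 0 ≤ x. Instead 1 - c η ≤ a < v^n forces 1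
    -- - c η ≤ v.
    w<u+½ε′+ε-if-x≤0 : s ≡ 0ℚ → x ≤ 0ℚ → w < u + (½ * ε′ + ε)
    w<u+½ε′+ε-if-x≤0 s≡0 x≤0 = begin-strict
      w                     ≡⟨ cong (λ s → (1ℚ + s) * (1ℚ + s)) s≡0 ⟩
      1ℚ                    ≡⟨ solve 1 (λ a → con 1ℚ := (con 1ℚ :- a) :+ a) refl (c * η) ⟩
      1ℚ - c * η + c * η    ≤⟨ +-monoˡ-≤ (c * η) 1-cη≤v ⟩
      u + μ + c * η    ≤⟨ +-monoˡ-≤ (c * η) (+-monoʳ-≤ u μ≤η) ⟩
      u + η + c * η         ≡⟨ solve 3 (λ u h c → u :+ h :+ c :* h := u :+ (c :+ con 1ℚ) :* h) refl u η c ⟩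
      u + (c + 1ℚ) * η      ≤⟨ +-monoʳ-≤ u (Dη-bound (c + 1ℚ)
                                 (p+r≡q⇒p≤q 0≤2Y₀ (+-comm (c + 1ℚ) (Y₀ + Y₀)))) ⟩
      u + ½ * ε′            ≡⟨ cong (λ z → u + z) (+-identityʳ (½ * ε′)) ⟨
      u + (½ * ε′ + 0ℚ)     <⟨ +-monoʳ-< u (+-monoʳ-< (½ * ε′) 0<ε) ⟩
      u + (½ * ε′ + ε)      ∎
      where
        ∣x∣≤η : ∣ x ∣ ≤ η
        ∣x∣≤η = begin
          ∣ x ∣    ≡⟨ trans (sym (∣-p∣≡∣p∣ x)) (0≤p⇒∣p∣≡p (neg-antimono-≤ x≤0)) ⟩
          - x      ≤⟨ <⇒≤ -x<η² ⟩
          η * η    ≤⟨ *-monoˡ η 0≤η η≤1 ⟩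
          η * 1ℚ   ≡⟨ *-identityʳ η ⟩
          η        ∎

        1-cη≤v : 1ℚ - c * η ≤ v
        1-cη≤v = b≤a^n⇒b≤a n 0≤v
          (p+r≡q⇒p≤q (*-nonNeg 0≤c 0≤η) (solve 1 (λ a → (con 1ℚ :- a) :+ a := con 1ℚ) refl (c * η)))
          (≤-trans (a-near-0 ∣x∣≤η) (<⇒≤ u-upper))

    w<u+½ε′+ε : w < u + (½ * ε′ + ε)
    w<u+½ε′+ε with s≡0⊎s²≤x | ≤-total 0ℚ x
    ... | inj₂ s²≤x | _        = w<u+½ε′+ε-if-s²≤x s²≤x
    ... | inj₁ s≡0  | inj₁ 0≤x = w<u+½ε′+ε-if-s²≤x (subst (_≤ x) (sym (trans (cong (_* s) s≡0) (*-zeroˡ s))) 0≤x)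
    ... | inj₁ s≡0  | inj₂ x≤0 = w<u+½ε′+ε-if-x≤0 s≡0 x≤0

    ∣u-w∣<ε+ε′ : ∣ u - w ∣ < ε + ε′
    ∣u-w∣<ε+ε′ = ∣p∣<ε u-w<ε+ε′ (subst (_< ε + ε′)
      (solve 2 (λ u w → w :- u := :- (u :- w)) refl u w) (finish {w} {u} w<u+½ε′+ε))


  -- Choice of the thresholds and the limit

  growth-bounds : ∀ {e L} → 0ℚ < e → 0ℚ ≤ L →
    ∃ λ N → ∀ n → N ℕ.≤ n → L < (1ℚ + e) ^ n × ι (suc n) ≤ (1ℚ + e) ^ n
  -- The product (L + 1)(n + 1) exceeds L and is at least n + 1, so one application of the growth
  -- lemma gives both bounds.
  growth-bounds {e} {L} 0<e 0≤L = split (exponential-beats-linear 0<e (+-mono-≤-< 0≤L (positive⁻¹ 1ℚ)))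
    where
      open ≤-Reasoning

      split : (∃ λ N → ∀ n → N ℕ.≤ n → (L + 1ℚ) * ι (suc n) ≤ (1ℚ + e) ^ n) →
              ∃ λ N → ∀ n → N ℕ.≤ n → L < (1ℚ + e) ^ n × ι (suc n) ≤ (1ℚ + e) ^ n
      split (N , grow) = N , λ n N≤n →
          (begin-strict
            L                     ≡⟨ +-identityʳ L ⟨
            L + 0ℚ                <⟨ +-monoʳ-< L (positive⁻¹ 1ℚ) ⟩
            L + 1ℚ                ≡⟨ *-identityʳ (L + 1ℚ) ⟨
            (L + 1ℚ) * 1ℚ         ≤⟨ *-monoˡ (L + 1ℚ) (+-nonNeg 0≤L 0≤1) (ι-mono {1} {suc n} (ℕ.s≤s ℕ.z≤n)) ⟩
            (L + 1ℚ) * ι (suc n)  ≤⟨ grow n N≤n ⟩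
            (1ℚ + e) ^ n          ∎)
        , (begin
            ι (suc n)             ≤⟨ p+r≡q⇒p≤q (*-nonNeg 0≤L (ι-nonNeg (suc n)))
                                       (solve 2 (λ L x → x :+ L :* x := (L :+ con 1ℚ) :* x) refl L (ι (suc n))) ⟩
            (L + 1ℚ) * ι (suc n)  ≤⟨ grow n N≤n ⟩
            (1ℚ + e) ^ n          ∎)

  divide : ∀ {b ε} → 0ℚ < b → 0ℚ < ε → ∃ λ e → 0ℚ < e × b * e ≡ ε
  -- `shrink` divides half of its argument, hence the doubled ε.
  divide {b} {ε} 0<b 0<ε with Real.shrink {b} {ε + ε} 0<b (+-mono-< 0<ε 0<ε)
  ... | e , 0<e , be≡ = e , 0<e , trans be≡ (trans (*-distribˡ-+ ½ ε ε) (½+½ ε))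

  small-unit : ∀ {δ} → 0ℚ < δ → ∃ λ η → 0ℚ < η × η ≤ δ × η ≤ 1ℚ
  small-unit {δ} 0<δ with mesh-small 0<δ | mesh-small {1ℚ} (positive⁻¹ 1ℚ)
  ... | M , ≤δ | N , ≤1 = mesh (M ℕ.⊔ N) , mesh-pos (M ℕ.⊔ N) ,
    ≤δ (M ℕ.⊔ N) (ℕₚ.m≤m⊔n M N) , ≤1 (M ℕ.⊔ N) (ℕₚ.m≤n⊔m M N)

  module _ (n κ : ℕ) .{{_ : ℕ.NonZero n}} (t : Real.ℝ) (0≤t : Real.0# Real.≤ t) {B N₀ e ε ε′}
    (0<B : 0ℚ < B) (∣t∣<B : ∀ {m} → N₀ ℕ.≤ m → ∣ Real.seq t m ∣ < B)
    (0<e : 0ℚ < e) (0<ε : 0ℚ < ε) (0<ε′ : 0ℚ < ε′) (We≡ε : rootBound B * rootBound B * e ≡ ε)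
    (Y₀^κ<gⁿ : rootBound B ^ κ < (1ℚ + e) ^ n) (ι[1+n]≤gⁿ : ι (suc n) ≤ (1ℚ + e) ^ n)
    where

    private
      j : ℚ → ℚ
      j = eval (J n (n ℕ.+ κ))

      Close : ℕ → Set
      Close m = ∣ approxRoot n (j (Real.seq t m)) m
        - (1ℚ + approxRoot 2 (Real.seq t m) m) * (1ℚ + approxRoot 2 (Real.seq t m) m) ∣ < ε + ε′

      -x<y : ∀ {x y} → 0ℚ < x + y → - x < y
      -x<y {x} {y} 0<x+y = subst₂ _<_ (+-identityʳ (- x))
        (solve 2 (λ x y → (:- x) :+ (x :+ y) := y) refl x y) (+-monoʳ-< (- x) 0<x+y)

      0<2Y₀ : 0ℚ < rootBound B + rootBound B
      0<2Y₀ = +-mono-< (rootBound-pos 0<B) (rootBound-pos 0<B)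

      0<D : ∀ {c} → 0ℚ ≤ c → 0ℚ < (rootBound B + rootBound B) + (c + 1ℚ)
      0<D 0≤c = +-mono-<-≤ 0<2Y₀ (+-nonNeg 0≤c 0≤1)

      close-at : ∀ {c η} m → 0ℚ ≤ c →
        (∀ {x η} → ∣ x ∣ ≤ η → η ≤ 1ℚ → 1ℚ - c * η ≤ j x) →
        0ℚ < η → η ≤ 1ℚ → ((rootBound B + rootBound B) + (c + 1ℚ)) * η ≤ ½ * ε′ →
        mesh m ≤ η → ∣ Real.seq t m ∣ < B → 0ℚ < Real.seq t m + η * η → Close m
      close-at {c} {η} m 0≤c near 0<η η≤1 Dη≤½ε′ mesh≤η ∣x∣<B 0<x+η² = RootEstimate.∣u-w∣<ε+ε′ n κ
        {B} {e} {ε} {ε′} {η} {c} {mesh m} {x} {approxRoot 2 x m} {approxRoot n (j x) m} {j x}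
        0<B 0<e 0<ε 0<ε′ 0<η η≤1 0≤c (mesh-pos m) mesh≤η We≡ε Dη≤½ε′ Y₀^κ<gⁿ ι[1+n]≤gⁿ
        (≤-<-trans (p≤∣p∣ x) ∣x∣<B) (-x<y {x} {η * η} 0<x+η²)
        (ApproxRoot.nonNeg 2 x m) (ApproxRoot.lower 2 x m) (ApproxRoot.upper 2 x m)
        (ApproxRoot.nonNeg n (j x) m) (ApproxRoot.lower n (j x) m) (ApproxRoot.upper n (j x) m)
        (J-upper n (n ℕ.+ κ) {x}) (J-lower n κ {x}) (λ ∣x∣≤η → near {x} ∣x∣≤η η≤1)
        where
          x : ℚ
          x = Real.seq t m

      choose-index : ∀ {c η} → 0ℚ ≤ c →
        (∀ {x η} → ∣ x ∣ ≤ η → η ≤ 1ℚ → 1ℚ - c * η ≤ j x) →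
        0ℚ < η → η ≤ 1ℚ → ((rootBound B + rootBound B) + (c + 1ℚ)) * η ≤ ½ * ε′ →
        (∃ λ N → ∀ {m} → N ℕ.≤ m → 0ℚ < Real.seq t m + η * η) →
        (∃ λ N → ∀ m → N ℕ.≤ m → mesh m ≤ η) →
        ∃ λ N → ∀ {m} → N ℕ.≤ m → Close m
      choose-index 0≤c near 0<η η≤1 Dη≤½ε′ (N₁ , 0<x+η²) (N₂ , mesh≤η) = (N₀ ℕ.⊔ N₁) ℕ.⊔ N₂ , λ {m} N≤m →
        close-at m 0≤c near 0<η η≤1 Dη≤½ε′
          (mesh≤η m (Real.≤-max-r {N₀ ℕ.⊔ N₁} {N₂} N≤m))
          (∣t∣<B (Real.≤-max-l {N₀} {N₁} (Real.≤-max-l {N₀ ℕ.⊔ N₁} {N₂} N≤m)))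
          (0<x+η² (Real.≤-max-r {N₀} {N₁} (Real.≤-max-l {N₀ ℕ.⊔ N₁} {N₂} N≤m)))

      choose-η : ∀ {c δ} → 0ℚ ≤ c →
        (∀ {x η} → ∣ x ∣ ≤ η → η ≤ 1ℚ → 1ℚ - c * η ≤ j x) →
        ((rootBound B + rootBound B) + (c + 1ℚ)) * δ ≡ ½ * ε′ →
        (∃ λ η → 0ℚ < η × η ≤ δ × η ≤ 1ℚ) →
        ∃ λ N → ∀ {m} → N ℕ.≤ m → Close m
      choose-η {c} {δ} 0≤c near Dδ≡½ε′ (η , 0<η , η≤δ , η≤1) = choose-index 0≤c near 0<η η≤1
        (subst (((rootBound B + rootBound B) + (c + 1ℚ)) * η ≤_) Dδ≡½ε′
          (*-monoˡ ((rootBound B + rootBound B) + (c + 1ℚ)) (<⇒≤ (0<D 0≤c)) η≤δ))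
        -- Nonnegativity of t with tolerance η² says that eventually - x < η².
        (0≤t (η * η) (*-pos 0<η 0<η)) (mesh-small 0<η)

      choose-δ : ∀ {c} → 0ℚ ≤ c →
        (∀ {x η} → ∣ x ∣ ≤ η → η ≤ 1ℚ → 1ℚ - c * η ≤ j x) →
        (∃ λ δ → 0ℚ < δ × ((rootBound B + rootBound B) + (c + 1ℚ)) * δ ≡ ½ * ε′) →
        ∃ λ N → ∀ {m} → N ℕ.≤ m → Close m
      choose-δ 0≤c near (δ , 0<δ , Dδ≡½ε′) = choose-η 0≤c near Dδ≡½ε′ (small-unit 0<δ)

      choose-c : (∃ λ c → 0ℚ ≤ c × (∀ {x η} → ∣ x ∣ ≤ η → η ≤ 1ℚ → 1ℚ - c * η ≤ j x)) →
        ∃ λ N → ∀ {m} → N ℕ.≤ m → Close m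
      choose-c (c , 0≤c , near) = choose-δ 0≤c near (Real.shrink (0<D 0≤c) 0<ε′)

    -- n is fixed here, so η may depend on it through c: η is at most 1 and at most δ with D δ = ½
    -- ε′.
    approxRoot-J-close : ∃ λ N → ∀ {m} → N ℕ.≤ m → Close m
    approxRoot-J-close = choose-c (J-near-0 n (n ℕ.+ κ))

  -- B depends on t, and e = ε / W on B and ε, so the threshold for n is found before ε′ appears.
  -- Given n and ε′, the index m is then taken large.
  J-root-limit : ∀ κ t → Real.0# Real.≤ t →
    (λ n → Real.root n (Real.⟦ J n (n ℕ.+ κ) ⟧ t)) Real.⟶ ((Real.1# Real.+ Real.√ t) Real.^ 2)
  J-root-limit κ t 0≤t ε 0<ε = choose-B (Real.bounded t)
    where
      s : ℕ → ℚ
      s m = approxRoot 2 (Real.seq t m) m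

      Goal : Set
      Goal = ∃ λ N → ∀ n .{{_ : ℕ.NonZero n}} → N ℕ.≤ n →
        Real.∣ Real.root n (Real.⟦ J n (n ℕ.+ κ) ⟧ t) Real.- (Real.1# Real.+ Real.√ t) Real.^ 2 ∣ᵣ
          Real.≤ Real.fromℚ ε

      to-sequence : ∀ n .{{_ : ℕ.NonZero n}} m ε′ →
        ∣ approxRoot n (eval (J n (n ℕ.+ κ)) (Real.seq t m)) m - (1ℚ + s m) * (1ℚ + s m) ∣ < ε + ε′ →
        ∣ approxRoot n (Real.seq (Real.⟦ J n (n ℕ.+ κ) ⟧ t) m) m - (1ℚ + s m) * ((1ℚ + s m) * 1ℚ) ∣ < ε + ε′
      to-sequence n m ε′ = subst₂ (λ a b → ∣ approxRoot n a m - (1ℚ + s m) * b ∣ < ε + ε′)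
        (sym (seq-⟦⟧ (J n (n ℕ.+ κ)) t m)) (sym (*-identityʳ (1ℚ + s m)))

      choose-N : ∀ {B N₀ e} → 0ℚ < B → (∀ {m} → N₀ ℕ.≤ m → ∣ Real.seq t m ∣ < B) →
        0ℚ < e → rootBound B * rootBound B * e ≡ ε →
        (∃ λ N → ∀ n → N ℕ.≤ n → rootBound B ^ κ < (1ℚ + e) ^ n × ι (suc n) ≤ (1ℚ + e) ^ n) → Goal
      choose-N {B} {N₀} {e} 0<B ∣t∣<B 0<e We≡ε (N , growth) = N , λ n N≤n ε′ 0<ε′ →
        let close = approxRoot-J-close n κ t 0≤t {N₀ = N₀} 0<B ∣t∣<B 0<e 0<ε 0<ε′ We≡ε
                      (proj₁ (growth n N≤n)) (proj₂ (growth n N≤n))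
        in proj₁ close , λ {m} N′≤m → to-sequence n m ε′ (proj₂ close N′≤m)

      choose-e : ∀ {B N₀} → 0ℚ < B → (∀ {m} → N₀ ℕ.≤ m → ∣ Real.seq t m ∣ < B) →
        (∃ λ e → 0ℚ < e × rootBound B * rootBound B * e ≡ ε) → Goal
      choose-e {B} {N₀} 0<B ∣t∣<B (e , 0<e , We≡ε) = choose-N {N₀ = N₀} 0<B ∣t∣<B 0<e We≡ε
        (growth-bounds 0<e (^-nonNeg κ (<⇒≤ (rootBound-pos 0<B))))

      choose-B : (∃ λ B → 0ℚ < B × ∃ λ N₀ → ∀ {m} → N₀ ℕ.≤ m → ∣ Real.seq t m ∣ < B) → Goal
      choose-B (B , 0<B , N₀ , ∣t∣<B) = choose-e {N₀ = N₀} 0<B ∣t∣<B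
        (divide (*-pos (rootBound-pos 0<B) (rootBound-pos 0<B)) 0<ε)

proposition4p10 : (κ : ℕ) →
  (let open ℚ[t]⟦z⟧
       numerator = 1# + (1# - t) * z - Δ
       quotient  = numerator /2z
   in ((2 · z) * quotient ≈ numerator)
    × (constantTerm quotient Polynomial.≈ₚ Polynomial.constant 1ℚ)
    × ((λ n → J n (n +ℕ κ)) ≈ Δ ⁻¹ * quotient ^ κ))
  ×
  (let open Real
   in (t : ℝ) → 0# ≤ t →
      (λ n → root n (⟦ J n (n +ℕ κ) ⟧ t)) ⟶ ((1# + √ t) ^ 2))
proposition4p10 κ =
  (G.2z*q , G.q-head , G.F≈Δ⁻¹*q^κ κ) , RootLimit.J-root-limit κ
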